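{- Let $q\ge 1$ and $n\ge q+5$ be integers. Then (1) $\mathrm{sat}(n, K_1\vee(2K_{2}\cup qK_1))=n+2$; (2) $\mathrm{SAT}(n, K_1\vee(2K_{2}\cup qK_1))=\{K_4^{+(n-4)}\}$ up to isomorphism.
   Context: All graphs are finite and simple. For graphs $F$ and $G$, $G$ is $F$-saturated if $G$ contains no copy of $F$ as a (not necessarily induced) subgraph, but for every edge $e$ of the complement $\overline{G}$, the graph $G+e$ obtained by adding $e$ to $G$ contains a copy of $F$. The saturation number $\mathrm{sat}(n,F)$ is the minimum number of edges in an $F$-saturated graph on $n$ vertices, and $\mathrm{SAT}(n,F)$ is the set (up to isomorphism) of $F$-saturated graphs on $n$ vertices with exactly $\mathrm{sat}(n,F)$ edges. $K_m$ is the complete graph on $m$ vertices, $\cup$ denotes vertex-disjoint union, $mG$ denotes the disjoint union of $m$ copies of $G$, and $G_1\vee G_2$ is the join, obtained from the disjoint union $G_1\cup G_2$ by adding all edges between $V(G_1)$ and $V(G_2)$. $K_s^{+t}$ denotes the graph obtained from the complete graph $K_s$ by attaching $t$ leaves (new vertices of degree one) to one and the same vertex of $K_s$. -}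

module Defs where

open import Data.Empty using (⊥)
open import Data.Fin.Base using (Fin; zero)
open import Data.Fin.Properties using (_≟_; _<?_)
open import Data.List.Base using (length; filter; allFin; cartesianProduct)
open import Data.Nat.Base as ℕ using (ℕ; suc; NonZero)
open import Data.Product.Base using (Σ-syntax; _×_; _,_; proj₁)
open import Data.Sum.Base using (_⊎_; inj₁; inj₂)
open import Data.Sum.Relation.Binary.Pointwise
  using (Pointwise; inj₁; inj₂; ⊎-symmetric; ⊎-decidable)
open import Data.Unit.Base using (⊤; tt)
open import Function.Base using (_∘_)
open import Function.Bundles using (_↔_; _⇔_; Inverse)
open import Function.Definitions using (Injective)
open import Level using (0ℓ)
open import Relation.Binary.Core using (Rel)
open import Relation.Binary.Definitions using (Symmetric; Irreflexive; Decidable)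
open import Relation.Binary.PropositionalEquality.Core using (_≡_; _≢_; refl; sym; ≢-sym)
open import Relation.Nullary using (¬_; yes; no)
open import Relation.Nullary.Decidable using (¬?; _×-dec_; _⊎-dec_)

private
  variable
    V W : Set
    m n : ℕ

-- Finiteness is a condition on V: the graphs below have vertex types built
-- from Fin by _⊎_ and _×_.
record Graph (V : Set) : Set₁ where
  field
    _~_    : Rel V 0ℓ
    symm   : Symmetric _~_
    irrefl : Irreflexive _≡_ _~_
    _~?_   : Decidable _~_

open Graph using (symm; irrefl)

infix 4 _[_~_] _[_~?_]

_[_~_] : Graph V → V → V → Set
G [ u ~ v ] = Graph._~_ G u v

_[_~?_] : (G : Graph V) → Decidable (G [_~_])
G [ u ~? v ] = Graph._~?_ G u v

K : (m : ℕ) → Graph (Fin m)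
K m = record
  { _~_    = _≢_
  ; symm   = ≢-sym
  ; irrefl = λ { refl u≢u → u≢u refl }
  ; _~?_   = λ u v → ¬? (u ≟ v)
  }

infixr 6 _∪_
infixr 5 _∨_
infixr 7 _·_

_∪_ : Graph V → Graph W → Graph (V ⊎ W)
G ∪ H = record
  { _~_    = Pointwise (G [_~_]) (H [_~_])
  ; symm   = ⊎-symmetric (symm G) (symm H)
  ; irrefl = λ { refl (inj₁ p) → irrefl G refl p ; refl (inj₂ p) → irrefl H refl p }
  ; _~?_   = ⊎-decidable (G [_~?_]) (H [_~?_])
  }

_·_ : (k : ℕ) → Graph V → Graph (Fin k × V)
k · G = record
  { _~_    = λ { (i , u) (j , v) → i ≡ j × G [ u ~ v ] }
  ; symm   = λ { (i≡j , p) → sym i≡j , symm G p }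
  ; irrefl = λ { refl (_ , p) → irrefl G refl p }
  ; _~?_   = λ { (i , u) (j , v) → (i ≟ j) ×-dec (G [ u ~? v ]) }
  }

_∨_ : Graph V → Graph W → Graph (V ⊎ W)
_∨_ {V} {W} G H = record
  { _~_    = adj
  ; symm   = λ {x} {y} → adj-sym x y
  ; irrefl = λ { {x} refl → adj-irrefl x }
  ; _~?_   = adj?
  }
  where
  adj : Rel (V ⊎ W) 0ℓ
  adj (inj₁ u) (inj₁ v) = G [ u ~ v ]
  adj (inj₁ _) (inj₂ _) = ⊤
  adj (inj₂ _) (inj₁ _) = ⊤
  adj (inj₂ u) (inj₂ v) = H [ u ~ v ]

  adj-sym : ∀ x y → adj x y → adj y x
  adj-sym (inj₁ _) (inj₁ _) p = symm G p
  adj-sym (inj₁ _) (inj₂ _) _ = tt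
  adj-sym (inj₂ _) (inj₁ _) _ = tt
  adj-sym (inj₂ _) (inj₂ _) p = symm H p

  adj-irrefl : ∀ x → ¬ adj x x
  adj-irrefl (inj₁ _) = irrefl G refl
  adj-irrefl (inj₂ _) = irrefl H refl

  adj? : Decidable adj
  adj? (inj₁ u) (inj₁ v) = G [ u ~? v ]
  adj? (inj₁ _) (inj₂ _) = yes tt
  adj? (inj₂ _) (inj₁ _) = yes tt
  adj? (inj₂ u) (inj₂ v) = H [ u ~? v ]

attachLeaves : Graph (Fin m) → Fin m → (t : ℕ) → Graph (Fin m ⊎ Fin t)
attachLeaves {m} G c t = record
  { _~_    = adj
  ; symm   = λ {x} {y} → adj-sym x y
  ; irrefl = λ { {x} refl → adj-irrefl x }
  ; _~?_   = adj?
  }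
  where
  adj : Rel (Fin m ⊎ Fin t) 0ℓ
  adj (inj₁ u) (inj₁ v) = G [ u ~ v ]
  adj (inj₁ u) (inj₂ _) = u ≡ c
  adj (inj₂ _) (inj₁ v) = v ≡ c
  adj (inj₂ _) (inj₂ _) = ⊥

  adj-sym : ∀ x y → adj x y → adj y x
  adj-sym (inj₁ _) (inj₁ _) p = symm G p
  adj-sym (inj₁ _) (inj₂ _) p = p
  adj-sym (inj₂ _) (inj₁ _) p = p

  adj-irrefl : ∀ x → ¬ adj x x
  adj-irrefl (inj₁ _) = irrefl G refl
  adj-irrefl (inj₂ _) = λ ()

  adj? : Decidable adj
  adj? (inj₁ u) (inj₁ v) = G [ u ~? v ]
  adj? (inj₁ u) (inj₂ _) = u ≟ c
  adj? (inj₂ _) (inj₁ v) = v ≟ c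
  adj? (inj₂ _) (inj₂ _) = no (λ ())

-- K⁺ s t is the graph K_s^{+t}; the choice of the vertex carrying the leaves
-- is immaterial up to isomorphism.
K⁺ : (s t : ℕ) .{{_ : NonZero s}} → Graph (Fin s ⊎ Fin t)
K⁺ s@(suc _) t = attachLeaves (K s) zero t

infix 4 _≅_ _⊑_

_≅_ : Graph V → Graph W → Set
_≅_ {V} {W} G H =
  Σ[ φ ∈ V ↔ W ] (∀ u v → G [ u ~ v ] ⇔ H [ Inverse.to φ u ~ Inverse.to φ v ])

-- F ⊑ G : G contains a copy of F as a (not necessarily induced) subgraph.
_⊑_ : Graph V → Graph W → Set
_⊑_ {V} {W} F G =
  Σ[ f ∈ (V → W) ] (Injective _≡_ _≡_ f × (∀ u v → F [ u ~ v ] → G [ f u ~ f v ]))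

complement : Graph (Fin n) → Graph (Fin n)
complement G = record
  { _~_    = λ u v → u ≢ v × ¬ G [ u ~ v ]
  ; symm   = λ { (u≢v , ¬p) → ≢-sym u≢v , ¬p ∘ symm G }
  ; irrefl = λ { refl (u≢u , _) → u≢u refl }
  ; _~?_   = λ u v → ¬? (u ≟ v) ×-dec ¬? (G [ u ~? v ])
  }

addEdge : Graph (Fin n) → {a b : Fin n} → a ≢ b → Graph (Fin n)
addEdge {n} G {a} {b} a≢b = record
  { _~_    = λ u v → G [ u ~ v ] ⊎ (u ≡ a × v ≡ b) ⊎ (u ≡ b × v ≡ a)
  ; symm   = λ { (inj₁ p)               → inj₁ (symm G p)
               ; (inj₂ (inj₁ (p , q))) → inj₂ (inj₂ (q , p))
               ; (inj₂ (inj₂ (p , q))) → inj₂ (inj₁ (q , p)) }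
  ; irrefl = λ { refl (inj₁ p)                  → irrefl G refl p
               ; refl (inj₂ (inj₁ (refl , q))) → a≢b q
               ; refl (inj₂ (inj₂ (refl , q))) → a≢b (sym q) }
  ; _~?_   = λ u v → (G [ u ~? v ])
               ⊎-dec ((u ≟ a) ×-dec (v ≟ b)) ⊎-dec ((u ≟ b) ×-dec (v ≟ a))
  }

-- Each edge is counted once, as the pair (i , j) with i < j.
size : Graph (Fin n) → ℕ
size {n} G =
  length (filter (λ { (i , j) → (i <? j) ×-dec (G [ i ~? j ]) })
                 (cartesianProduct (allFin n) (allFin n)))

Saturated : Graph V → Graph (Fin n) → Set
Saturated F G =
  ¬ (F ⊑ G) ×
  (∀ u v (e : complement G [ u ~ v ]) → F ⊑ addEdge G (proj₁ e))

-- IsSat n F k : sat(n, F) = k.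
IsSat : (n : ℕ) → Graph V → ℕ → Set₁
IsSat n F k =
  (Σ[ G ∈ Graph (Fin n) ] (Saturated F G × size G ≡ k)) ×
  ((G : Graph (Fin n)) → Saturated F G → k ℕ.≤ size G)

-- InSAT n F G : the isomorphism class of G belongs to SAT(n, F).
InSAT : (n : ℕ) → Graph V → Graph (Fin n) → Set₁
InSAT n F G = Saturated F G × IsSat n F (size G)

{-# OPTIONS --safe #-}

-- A graph contains K₁ ∨ (2K₂ ∪ qK₁) iff some vertex of degree at least q + 4 has
-- two disjoint edges in its neighbourhood.  Hence in a saturated graph every
-- non-adjacent pair either has a common neighbour of degree at least q + 4, or one
-- of the two has degree at least q + 3 ≥ 4.  If there is an isolated vertex, or if
-- all degrees are at least 2, enough vertices of large degree are forced to push the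
-- degree sum to 2n + 5 or more.  If there is a leaf v with neighbour w, a vertex
-- outside N[w] has degree at least q + 3 and again the degree sum is at least 2n + 5;
-- so w is dominating, the edges avoiding w pairwise intersect, and joining v to the
-- other vertices shows that they have no common vertex: they form a triangle, and
-- the graph is K₄ with n - 4 leaves attached at w, of degree sum 2n + 4.

module Submission where

open import Defs
open import Data.Bool.Base using (if_then_else_)
open import Data.Empty using (⊥; ⊥-elim)
open import Data.Fin.Base using (Fin; zero; suc; combine; _↑ˡ_; splitAt; punchIn; punchOut)
open import Data.Fin.Permutation using (Permutation; _⟨$⟩ʳ_; insert; insert-punchIn)
import Data.Fin.Permutation as Permutation
open import Data.Fin.Properties
  using (_≟_; _<?_; <-cmp; any?; injective⇒≤; combine-injective; +↔⊎; splitAt-↑ˡ; splitAt-join;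
         punchOut-injective; punchIn-punchOut)
import Data.Fin.Properties as Fin
open import Data.List.Base
  using (List; []; _∷_; _++_; length; lookup; map; filter; tabulate; cartesianProduct)
import Data.List.Membership.DecPropositional as DecMembership
open import Data.List.Membership.Propositional using (_∈_; _∉_)
open import Data.List.Membership.Propositional.Properties using (∈-lookup)
open import Data.List.Properties using (length-++; length-map; length-tabulate; filter-++)
open import Data.List.Relation.Unary.All using (All; []; _∷_)
import Data.List.Relation.Unary.All as All
import Data.List.Relation.Unary.All.Properties as All
open import Data.List.Relation.Unary.AllPairs using ([]; _∷_)
open import Data.List.Relation.Unary.Any using (here; there)
open import Data.List.Relation.Unary.Unique.Propositional using (Unique)
import Data.List.Relation.Unary.Unique.Propositional.Properties as Unique
open import Data.Nat.Base using (ℕ; zero; suc; _+_; _*_; _∸_; _≤_; _≥_; z≤n; s≤s)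
import Data.Nat.ListAction as ListAction
open import Data.Nat.Properties hiding (_≟_; _<?_; <-cmp)
open import Data.Nat.Solver using (module +-*-Solver)
open import Data.Product.Base using (Σ-syntax; ∃; _×_; _,_; proj₁; proj₂)
open import Data.Sum.Base using (_⊎_; inj₁; inj₂; [_,_]′)
open import Data.Sum.Properties using (inj₁-injective)
import Data.Sum.Relation.Binary.Pointwise as Pointwise
open import Function.Base using (_∘_; id)
open import Function.Bundles using (_↔_; _⇔_; Inverse; Equivalence; mk⇔)
open import Function.Definitions using (Injective)
open import Function.Properties.Inverse using (↔-trans; ↔-sym)
open import Relation.Binary.Definitions using (tri<; tri≈; tri>)
open import Relation.Binary.PropositionalEquality
open import Relation.Nullary using (¬_; Dec; yes; no; does; contradiction)
open import Relation.Nullary.Decidable using (¬?; _×-dec_; decidable-stable; dec-yes)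
open import Relation.Unary using (Decidable)

open import Algebra.Properties.CommutativeMonoid.Sum +-0-commutativeMonoid
  using (sum; sum-cong-≗; sum-replicate-zero; ∑-distrib-+; ∑-comm; sum-permute)
open +-*-Solver using (solve; _:+_; _:*_; _:=_; con)
open module FinMembership {n} = DecMembership (_≟_ {n}) using (_∈?_)

private
  variable
    m n q t : ℕ
    A B : Set

-- Indicators and finite sums.

χ : Dec A → ℕ
χ d = if does d then 1 else 0

χ-true : (d : Dec A) → A → χ d ≡ 1
χ-true (yes _) _ = refl
χ-true (no ¬a) a = contradiction a ¬a

χ-false : (d : Dec A) → ¬ A → χ d ≡ 0
χ-false (yes a) ¬a = contradiction a ¬a
χ-false (no _)  _  = refl

χ≤1 : (d : Dec A) → χ d ≤ 1
χ≤1 (yes _) = s≤s z≤n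
χ≤1 (no _)  = z≤n

χ-mono : (d : Dec A) (e : Dec B) → (A → B) → χ d ≤ χ e
χ-mono (yes a) e f = ≤-reflexive (sym (χ-true e (f a)))
χ-mono (no _)  e f = z≤n

χ-cong : (d : Dec A) (e : Dec B) → (A → B) → (B → A) → χ d ≡ χ e
χ-cong d e f g = ≤-antisym (χ-mono d e f) (χ-mono e d g)

χ-¬ : (d : Dec A) → χ d + χ (¬? d) ≡ 1
χ-¬ (yes _) = refl
χ-¬ (no _)  = refl

sum-mono : {f g : Fin n → ℕ} → (∀ x → f x ≤ g x) → sum f ≤ sum g
sum-mono {zero}  f≤g = z≤n
sum-mono {suc n} f≤g = +-mono-≤ (f≤g zero) (sum-mono (f≤g ∘ suc))

sum-const : ∀ n k → sum {n} (λ _ → k) ≡ n * k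
sum-const zero    k = refl
sum-const (suc n) k = cong (k +_) (sum-const n k)

sum-scale : ∀ k (f : Fin n → ℕ) → sum (λ x → k * f x) ≡ k * sum f
sum-scale {zero}  k f = sym (*-zeroʳ k)
sum-scale {suc n} k f =
  trans (cong (k * f zero +_) (sum-scale k (f ∘ suc))) (sym (*-distribˡ-+ k (f zero) _))

sum-point : (y : Fin n) (f : Fin n → ℕ) → sum (λ x → χ (x ≟ y) * f x) ≡ f y
sum-point {suc n} zero    f = trans (cong₂ _+_ (+-identityʳ _) (sum-replicate-zero n)) (+-identityʳ _)
sum-point {suc n} (suc y) f = sum-point y (f ∘ suc)

sumOver : (A → ℕ) → List A → ℕ
sumOver f ys = ListAction.sum (map f ys)

-- Uniqueness of `ys` makes each entry contribute once, so the indicator of membership splits off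
-- the head without overlap.
sum-members : (f : Fin n → ℕ) {ys : List (Fin n)} → Unique ys →
              sum (λ x → χ (x ∈? ys) * f x) ≡ sumOver f ys
sum-members {n} f {[]} [] = sum-replicate-zero n
sum-members f {y ∷ ys} (y∉ys ∷ ys!) = begin
  sum (λ x → χ (x ∈? (y ∷ ys)) * f x)                          ≡⟨ sum-cong-≗ split ⟩
  sum (λ x → χ (x ≟ y) * f x + χ (x ∈? ys) * f x)              ≡⟨ ∑-distrib-+ (λ x → χ (x ≟ y) * f x) _ ⟩
  sum (λ x → χ (x ≟ y) * f x) + sum (λ x → χ (x ∈? ys) * f x)  ≡⟨ cong₂ _+_ (sum-point y f) (sum-members f ys!) ⟩
  f y + sumOver f ys                                           ∎
  where
  open ≡-Reasoning
  split : ∀ x → χ (x ∈? (y ∷ ys)) * f x ≡ χ (x ≟ y) * f x + χ (x ∈? ys) * f x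
  split x with x ≟ y | x ∈? ys
  ... | yes refl | yes y∈ys = contradiction refl (All.lookup y∉ys y∈ys)
  ... | yes refl | no _     = sym (+-identityʳ _)
  ... | no _     | yes _    = refl
  ... | no _     | no _     = refl

-- sum g ≤ sum f, improved by the exact values on ys; the terms over ys are moved to
-- the side where no subtraction occurs.
exchange : (f g : Fin n → ℕ) {ys : List (Fin n)} → Unique ys →
           (∀ x → x ∉ ys → g x ≤ f x) →
           sum g + sumOver f ys ≤ sum f + sumOver g ys
exchange f g {ys} ys! g≤f = begin
  sum g + sumOver f ys                       ≡⟨ cong (sum g +_) (sum-members f ys!) ⟨
  sum g + sum (λ x → χ (x ∈? ys) * f x)      ≡⟨ ∑-distrib-+ g _ ⟨
  sum (λ x → g x + χ (x ∈? ys) * f x)        ≤⟨ sum-mono pointwise ⟩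
  sum (λ x → f x + χ (x ∈? ys) * g x)        ≡⟨ ∑-distrib-+ f _ ⟩
  sum f + sum (λ x → χ (x ∈? ys) * g x)      ≡⟨ cong (sum f +_) (sum-members g ys!) ⟩
  sum f + sumOver g ys                       ∎
  where
  open ≤-Reasoning
  pointwise : ∀ x → g x + χ (x ∈? ys) * f x ≤ f x + χ (x ∈? ys) * g x
  pointwise x with x ∈? ys
  ... | yes _   = ≤-reflexive
    (solve 2 (λ a b → b :+ con 1 :* a := a :+ con 1 :* b) refl (f x) (g x))
  ... | no x∉ys = +-monoˡ-≤ 0 (g≤f x x∉ys)

-- Counting the elements of a decidable predicate.

count : {P : Fin n → Set} → Decidable P → ℕ
count P? = sum (λ x → χ (P? x))

length≤count : {P : Fin n → Set} (P? : Decidable P) {ys : List (Fin n)} →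
               Unique ys → All P ys → length ys ≤ count P?
length≤count {n} {P} P? {ys} ys! Pys = begin
  length ys                                    ≡⟨ on-P Pys ⟨
  sumOver (λ x → χ (P? x)) ys                  ≡⟨ cong (_+ sumOver _ ys) (sum-replicate-zero n) ⟨
  sum {n} (λ _ → 0) + sumOver (λ x → χ (P? x)) ys  ≤⟨ exchange _ _ ys! (λ _ _ → z≤n) ⟩
  count P? + sumOver (λ _ → 0) ys              ≡⟨ cong (count P? +_) (zeros ys) ⟩
  count P? + 0                                 ≡⟨ +-identityʳ _ ⟩
  count P?                                     ∎
  where
  open ≤-Reasoning
  on-P : ∀ {zs} → All P zs → sumOver (λ x → χ (P? x)) zs ≡ length zs
  on-P []         = refl
  on-P (p ∷ ps) = cong₂ _+_ (χ-true (P? _) p) (on-P ps)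
  zeros : ∀ zs → sumOver {A = Fin n} (λ _ → 0) zs ≡ 0
  zeros []       = refl
  zeros (_ ∷ zs) = zeros zs

select : {P : Fin n → Set} (P? : Decidable P) (k : ℕ) → k ≤ count P? →
         Σ[ f ∈ (Fin k → Fin n) ] ((∀ {i j} → f i ≡ f j → i ≡ j) × (∀ i → P (f i)))
select {zero}  P? zero    _ = (λ ()) , (λ { {()} }) , λ ()
select {suc n} P? zero    _ = (λ ()) , (λ { {()} }) , λ ()
select {suc n} {P} P? (suc k) k≤ with P? zero
... | no _ with select (P? ∘ suc) (suc k) k≤
...   | f , inj , Pf = suc ∘ f , inj ∘ Fin.suc-injective , Pf
select {suc n} {P} P? (suc k) (s≤s k≤) | yes p₀ with select (P? ∘ suc) k k≤
... | f , inj , Pf = f′ , inj′ , Pf′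
  where
  f′ : Fin (suc k) → Fin (suc n)
  f′ zero    = zero
  f′ (suc i) = suc (f i)
  inj′ : ∀ {i j} → f′ i ≡ f′ j → i ≡ j
  inj′ {zero}  {zero}  _  = refl
  inj′ {suc i} {suc j} eq = cong suc (inj (Fin.suc-injective eq))
  Pf′ : ∀ i → P (f′ i)
  Pf′ zero    = p₀
  Pf′ (suc i) = Pf i

-- Degrees and the handshake identity.

deg : Graph (Fin n) → Fin n → ℕ
deg G u = count (G [ u ~?_])

length-filter-map-tabulate : {P : B → Set} (P? : Decidable P) (h : A → B) (f : Fin m → A) →
  length (filter P? (map h (tabulate f))) ≡ count (λ i → P? (h (f i)))
length-filter-map-tabulate {m = zero}  P? h f = refl
length-filter-map-tabulate {m = suc m} P? h f with P? (h (f zero))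
... | yes _ = cong suc (length-filter-map-tabulate P? h (f ∘ suc))
... | no _  = length-filter-map-tabulate P? h (f ∘ suc)

length-filter-cartesianProduct : {P : A × B → Set} (P? : Decidable P)
  (f : Fin m → A) (g : Fin n → B) →
  length (filter P? (cartesianProduct (tabulate f) (tabulate g))) ≡
  sum (λ i → count (λ j → P? (f i , g j)))
length-filter-cartesianProduct {m = zero}  P? f g = refl
length-filter-cartesianProduct {m = suc m} P? f g = begin
  length (filter P? (row ++ rows))                     ≡⟨ cong length (filter-++ P? row rows) ⟩
  length (filter P? row ++ filter P? rows)             ≡⟨ length-++ (filter P? row) ⟩
  length (filter P? row) + length (filter P? rows)     ≡⟨ cong₂ _+_ (length-filter-map-tabulate P? _ g)
                                                            (length-filter-cartesianProduct P? (f ∘ suc) g) ⟩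
  _                                                    ∎
  where
  open ≡-Reasoning
  row  = map (f zero ,_) (tabulate g)
  rows = cartesianProduct (tabulate (f ∘ suc)) (tabulate g)

-- Each adjacent ordered pair is either increasing or decreasing. Exchanging the two summations
-- turns the decreasing pairs into increasing ones, which are the pairs that `size` counts.
handshake : (G : Graph (Fin n)) → sum (deg G) ≡ size G + size G
handshake {n} G = begin
  sum (λ i → sum (λ j → χ (G [ i ~? j ])))           ≡⟨ sum-cong-≗ (λ i → trans (sum-cong-≗ (orient i))
                                                              (∑-distrib-+ (up i) (λ j → up j i))) ⟩
  sum (λ i → sum (up i) + sum (λ j → up j i))        ≡⟨ ∑-distrib-+ (λ i → sum (up i)) _ ⟩
  sum (λ i → sum (up i)) + sum (λ i → sum (λ j → up j i))  ≡⟨ cong₂ _+_ refl (∑-comm (λ i j → up j i)) ⟩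
  sum (λ i → sum (up i)) + sum (λ i → sum (up i))    ≡⟨ cong₂ _+_ sz sz ⟨
  size G + size G                                    ∎
  where
  open ≡-Reasoning
  up : Fin n → Fin n → ℕ
  up i j = χ ((i <? j) ×-dec (G [ i ~? j ]))
  sz : size G ≡ sum (λ i → sum (up i))
  sz = length-filter-cartesianProduct (λ { (i , j) → (i <? j) ×-dec (G [ i ~? j ]) }) id id
  orient : ∀ i j → χ (G [ i ~? j ]) ≡ up i j + up j i
  orient i j with <-cmp i j
  ... | tri< i<j _ j≮i = sym (trans (cong₂ _+_
          (χ-cong (i <? j ×-dec (G [ i ~? j ])) (G [ i ~? j ]) proj₂ (i<j ,_))
          (χ-false (j <? i ×-dec (G [ j ~? i ])) (j≮i ∘ proj₁))) (+-identityʳ _))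
  ... | tri> i≮j _ j<i = sym (cong₂ _+_
          (χ-false (i <? j ×-dec (G [ i ~? j ])) (i≮j ∘ proj₁))
          (χ-cong (j <? i ×-dec (G [ j ~? i ])) (G [ i ~? j ])
            (Graph.symm G ∘ proj₂) (λ p → j<i , Graph.symm G p)))
  ... | tri≈ i≮i refl _ = trans (χ-false (G [ i ~? i ]) (Graph.irrefl G refl))
          (sym (cong₂ _+_ (χ-false (i <? i ×-dec (G [ i ~? i ])) (i≮i ∘ proj₁))
                          (χ-false (i <? i ×-dec (G [ i ~? i ])) (i≮i ∘ proj₁))))

-- Copies of the forbidden graph as centres of large degree.

-- Two triangles and `q` pendant edges, all sharing one hub vertex.
Fan : (q : ℕ) → Graph (Fin 1 ⊎ ((Fin 2 × Fin 2) ⊎ (Fin q × Fin 1)))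
Fan q = K 1 ∨ (2 · K 2 ∪ q · K 1)

adjacent⇒≢ : (G : Graph (Fin n)) → ∀ {x y} → G [ x ~ y ] → x ≢ y
adjacent⇒≢ G x~y refl = Graph.irrefl G refl x~y

-- The predicate on the ends is a parameter because it varies: adjacency to a centre, adjacency up
-- to one added neighbour, or avoidance of a vertex.
record TwoEdges (G : Graph (Fin n)) (P : Fin n → Set) : Set where
  constructor twoEdges
  field
    {p p′ r r′} : Fin n
    p~p′        : G [ p ~ p′ ]
    r~r′        : G [ r ~ r′ ]
    distinct    : Unique (p ∷ p′ ∷ r ∷ r′ ∷ [])
    ends        : All P (p ∷ p′ ∷ r ∷ r′ ∷ [])

mapTwoEdges : ∀ {G H : Graph (Fin n)} {P Q : Fin n → Set} →
  (∀ {x y} → P x → P y → G [ x ~ y ] → H [ x ~ y ]) → (∀ {x} → P x → Q x) →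
  TwoEdges G P → TwoEdges H Q
mapTwoEdges edge end (twoEdges e e′ u ps@(a ∷ b ∷ c ∷ d ∷ [])) =
  twoEdges (edge a b e) (edge c d e′) u (All.map end ps)

-- The number `q + 4` is the degree of the hub of `Fan q`: four triangle vertices and `q` leaves.
Centre : ℕ → (G : Graph (Fin n)) → Fin n → Set
Centre q G c = q + 4 ≤ deg G c × TwoEdges G (G [ c ~_])

⊑⇒centre : {G : Graph (Fin n)} → Fan q ⊑ G → ∃ (Centre q G)
⊑⇒centre {n} {q} {G} (f , inj , hom) = c , q+4≤deg , twoEdges
    (hom (petal zero zero) (petal zero (suc zero)) (Pointwise.inj₁ (refl , λ ())))
    (hom (petal (suc zero) zero) (petal (suc zero) (suc zero)) (Pointwise.inj₁ (refl , λ ())))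
    petals-unique
    (spoke _ ∷ spoke _ ∷ spoke _ ∷ spoke _ ∷ [])
  where


  c = f (inj₁ zero)
  petal : Fin 2 → Fin 2 → _
  petal i j = inj₂ (inj₁ (i , j))
  leaf : Fin q → _
  leaf i = inj₂ (inj₂ (i , zero))
  spoke : ∀ x → G [ c ~ f (inj₂ x) ]
  spoke x = hom (inj₁ zero) (inj₂ x) _
  petals = petal zero zero ∷ petal zero (suc zero) ∷ petal (suc zero) zero ∷ petal (suc zero) (suc zero) ∷ []
  petals-unique : Unique (map f petals)
  petals-unique = Unique.map⁺ inj
    (((λ ()) ∷ (λ ()) ∷ (λ ()) ∷ []) ∷ ((λ ()) ∷ (λ ()) ∷ []) ∷ ((λ ()) ∷ []) ∷ [] ∷ [])
  all-unique : Unique (petals ++ tabulate leaf)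
  all-unique =
    ((λ ()) ∷ (λ ()) ∷ (λ ()) ∷ All.tabulate⁺ λ _ ()) ∷
    ((λ ()) ∷ (λ ()) ∷ All.tabulate⁺ λ _ ()) ∷
    ((λ ()) ∷ All.tabulate⁺ λ _ ()) ∷
    All.tabulate⁺ (λ _ ()) ∷
    Unique.tabulate⁺ λ { refl → refl }
  q+4≤deg : q + 4 ≤ deg G c
  q+4≤deg = begin
    q + 4                                  ≡⟨ +-comm q 4 ⟩
    4 + q                                  ≡⟨ cong (4 +_) (trans (length-map f (tabulate leaf)) (length-tabulate leaf)) ⟨
    length (map f (petals ++ tabulate leaf))  ≤⟨ length≤count (G [ c ~?_]) (Unique.map⁺ inj all-unique)
      (All.map⁺ {f = f} (spoke _ ∷ spoke _ ∷ spoke _ ∷ spoke _ ∷ All.tabulate⁺ (λ i → spoke _))) ⟩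
    deg G c                                ∎
    where open ≤-Reasoning

lookup-injective : ∀ {A : Set} {xs : List A} → Unique xs → Injective _≡_ _≡_ (lookup xs)
lookup-injective {xs = x ∷ xs} (x∉ ∷ u) {zero}  {zero}  eq = refl
lookup-injective {xs = x ∷ xs} (x∉ ∷ u) {zero}  {suc j} eq =
  contradiction eq (All.lookup x∉ (∈-lookup {xs = xs} j))
lookup-injective {xs = x ∷ xs} (x∉ ∷ u) {suc i} {zero}  eq =
  contradiction (sym eq) (All.lookup x∉ (∈-lookup {xs = xs} i))
lookup-injective {xs = x ∷ xs} (x∉ ∷ u) {suc i} {suc j} eq = cong suc (lookup-injective u eq)

[,]-injective : ∀ {A B C : Set} {f : A → C} {g : B → C} → Injective _≡_ _≡_ f → Injective _≡_ _≡_ g →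
                (∀ a b → f a ≢ g b) → Injective _≡_ _≡_ [ f , g ]′
[,]-injective f-inj g-inj f≢g {inj₁ a} {inj₁ a′} eq = cong inj₁ (f-inj eq)
[,]-injective f-inj g-inj f≢g {inj₁ a} {inj₂ b}  eq = contradiction eq (f≢g a b)
[,]-injective f-inj g-inj f≢g {inj₂ b} {inj₁ a}  eq = contradiction (sym eq) (f≢g a b)
[,]-injective f-inj g-inj f≢g {inj₂ b} {inj₂ b′} eq = cong inj₂ (g-inj eq)

-- The two edges occupy only four neighbours of `c`. Off these four, being a neighbour and being
-- `Spare` agree, so at least `q` neighbours remain to serve as leaves.
centre⇒⊑ : {G : Graph (Fin n)} {c : Fin n} → Centre q G c → Fan q ⊑ G
centre⇒⊑ {n} {q} {G} {c} (q+4≤deg , twoEdges {p} {p′} {r} {r′} p~p′ r~r′ distinct ends) =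
  place , place-injective , place-hom
  where
  petals = p ∷ p′ ∷ r ∷ r′ ∷ []
  Spare : Fin n → Set
  Spare x = G [ c ~ x ] × x ∉ petals
  spare? : Decidable Spare
  spare? x = (G [ c ~? x ]) ×-dec ¬? (x ∈? petals)
  q≤spare : q ≤ count spare?
  q≤spare = +-cancelʳ-≤ 4 q (count spare?) (begin
    q + 4                                                    ≤⟨ q+4≤deg ⟩
    deg G c                                                  ≤⟨ m≤m+n _ _ ⟩
    deg G c + sumOver (λ x → χ (spare? x)) petals            ≤⟨ exchange _ _ distinct
      (λ x x∉ → χ-mono (G [ c ~? x ]) (spare? x) (_, x∉)) ⟩
    count spare? + sumOver (λ x → χ (G [ c ~? x ])) petals   ≤⟨ +-monoʳ-≤ (count spare?)
      (+-mono-≤ (χ≤1 (G [ c ~? p ])) (+-mono-≤ (χ≤1 (G [ c ~? p′ ]))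
        (+-mono-≤ (χ≤1 (G [ c ~? r ])) (+-mono-≤ (χ≤1 (G [ c ~? r′ ])) z≤n)))) ⟩
    count spare? + 4                                         ∎)
    where open ≤-Reasoning
  leaves = select spare? q q≤spare
  placePetal : Fin 2 × Fin 2 → Fin n
  -- `combine` sends edge `i` and end `j` to position `2i + j`, which is the order of the entries of
  -- `petals`.
  placePetal (i , j) = lookup petals (combine i j)
  placeLeaf : Fin q × Fin 1 → Fin n
  placeLeaf (i , _) = proj₁ leaves i
  place : Fin 1 ⊎ ((Fin 2 × Fin 2) ⊎ (Fin q × Fin 1)) → Fin n
  place = [ (λ _ → c) , [ placePetal , placeLeaf ]′ ]′
  spoke : ∀ x → G [ c ~ [ placePetal , placeLeaf ]′ x ]
  spoke (inj₁ (i , j)) = All.lookup ends (∈-lookup {xs = petals} (combine i j))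
  spoke (inj₂ (i , _)) = proj₁ (proj₂ (proj₂ leaves) i)
  place-injective : Injective _≡_ _≡_ place
  place-injective = [,]-injective (λ { {zero} {zero} _ → refl })
    ([,]-injective
      (λ { {i , j} {k , l} eq → case-× (combine-injective i j k l (lookup-injective distinct eq)) })
      (λ { {i , zero} {j , zero} eq → cong (_, zero) (proj₁ (proj₂ leaves) eq) })
      (λ { (i , j) (k , _) eq → proj₂ (proj₂ (proj₂ leaves) k)
             (subst (_∈ petals) eq (∈-lookup {xs = petals} (combine i j))) }))
    (λ _ x → adjacent⇒≢ G (spoke x))
    where
    case-× : ∀ {i j k l} → i ≡ k × j ≡ l → (i , j) ≡ (k , l)
    case-× (refl , refl) = refl
  petal-edge : ∀ i j l → j ≢ l → G [ placePetal (i , j) ~ placePetal (i , l) ]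
  petal-edge zero       zero       (suc zero) _ = p~p′
  petal-edge zero       (suc zero) zero       _ = Graph.symm G p~p′
  petal-edge (suc zero) zero       (suc zero) _ = r~r′
  petal-edge (suc zero) (suc zero) zero       _ = Graph.symm G r~r′
  petal-edge _          zero       zero       0≢0 = contradiction refl 0≢0
  petal-edge _          (suc zero) (suc zero) 1≢1 = contradiction refl 1≢1
  place-hom : ∀ x y → Fan q [ x ~ y ] → G [ place x ~ place y ]
  place-hom (inj₁ zero) (inj₁ zero) 0≢0 = contradiction refl 0≢0
  place-hom (inj₁ _) (inj₂ y) _ = spoke y
  place-hom (inj₂ x) (inj₁ _) _ = Graph.symm G (spoke x)
  place-hom (inj₂ (inj₁ (i , j))) (inj₂ (inj₁ (_ , l))) (Pointwise.inj₁ (refl , j≢l)) = petal-edge i j l j≢l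
  place-hom (inj₂ (inj₂ (i , zero))) (inj₂ (inj₂ (j , zero))) (Pointwise.inj₂ (_ , ne)) = contradiction refl ne

-- The effect of adding one edge.

-- The added edge uv is a spoke at the centre u, so v itself may be an end of the two edges.
At : ℕ → (G : Graph (Fin n)) → Fin n → Fin n → Set
At q G u v = q + 3 ≤ deg G u × TwoEdges G (λ x → G [ u ~ x ] ⊎ x ≡ v)

-- The added edge uv is one of the two disjoint edges around the centre c, and yz is the other.
Through : ℕ → (G : Graph (Fin n)) → Fin n → Fin n → Set
Through {n} q G u v = Σ[ c ∈ Fin n ] (q + 4 ≤ deg G c × G [ c ~ u ] × G [ c ~ v ] ×
  (Σ[ y ∈ Fin n ] Σ[ z ∈ Fin n ] (G [ c ~ y ] × G [ c ~ z ] × G [ y ~ z ] ×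
    (y ≢ u × y ≢ v) × (z ≢ u × z ≢ v))))

-- Only this bound on the edges of `H` is kept, in place of `addEdge` itself; it is symmetric in `u`
-- and `v`, so one lemma treats a centre at either end of the added edge.
AddsEdge : (G H : Graph (Fin n)) (u v : Fin n) → Set
AddsEdge G H u v = ∀ {x y} → H [ x ~ y ] → G [ x ~ y ] ⊎ (x ≡ u × y ≡ v) ⊎ (x ≡ v × y ≡ u)

-- Removing `uv` costs `u` at most the neighbour `v`, hence one unit of degree. The two edges join
-- neighbours of `u`, so they do not contain `u` and already lie in `G`.
centre-at-end : {G H : Graph (Fin n)} {u v : Fin n} → AddsEdge G H u v → u ≢ v →
                Centre q H u → At q G u v
centre-at-end {n} {q} {G} {H} {u} {v} add u≢v (q+4≤ , edges) =
  q+3≤ , mapTwoEdges edge end edges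
  where
  end : ∀ {x} → H [ u ~ x ] → G [ u ~ x ] ⊎ x ≡ v
  end u~x with add u~x
  ... | inj₁ g                = inj₁ g
  ... | inj₂ (inj₁ (_ , x≡v)) = inj₂ x≡v
  ... | inj₂ (inj₂ (u≡v , _)) = contradiction u≡v u≢v
  edge : ∀ {x y} → H [ u ~ x ] → H [ u ~ y ] → H [ x ~ y ] → G [ x ~ y ]
  edge u~x u~y x~y with add x~y
  ... | inj₁ g                = g
  ... | inj₂ (inj₁ (x≡u , _)) = contradiction (sym x≡u) (adjacent⇒≢ H u~x)
  ... | inj₂ (inj₂ (_ , y≡u)) = contradiction (sym y≡u) (adjacent⇒≢ H u~y)
  q+3≤ : q + 3 ≤ deg G u
  q+3≤ = +-cancelʳ-≤ 1 (q + 3) (deg G u) (begin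
    q + 3 + 1                                     ≡⟨ +-assoc q 3 1 ⟩
    q + 4                                         ≤⟨ q+4≤ ⟩
    deg H u                                       ≤⟨ m≤m+n _ _ ⟩
    deg H u + (χ (G [ u ~? v ]) + 0)              ≤⟨ exchange (λ x → χ (G [ u ~? x ])) (λ x → χ (H [ u ~? x ]))
      ([] ∷ []) (λ x x∉ → χ-mono (H [ u ~? x ]) (G [ u ~? x ])
        (λ h → [ id , (λ x≡v → contradiction (here x≡v) x∉) ]′ (end h))) ⟩
    deg G u + (χ (H [ u ~? v ]) + 0)              ≤⟨ +-monoʳ-≤ (deg G u) (+-monoˡ-≤ 0 (χ≤1 (H [ u ~? v ]))) ⟩
    deg G u + 1                                   ∎)
    where open ≤-Reasoning

-- All spokes at `c` lie in `G`, so `c` can only fail to be a centre of `G` if one of the two edges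
-- is `uv`. By disjointness the other edge lies in `G` and avoids `u` and `v`.
centre-off-ends : {G H : Graph (Fin n)} {u v : Fin n} → AddsEdge G H u v → ∀ {c} → c ≢ u → c ≢ v →
                  Centre q H c → ¬ Centre q G c → Through q G u v
centre-off-ends {n} {q} {G} {H} {u} {v} add {c} c≢u c≢v
  (q+4≤ , twoEdges {p} {p′} {r} {r′} p~p′ r~r′ distinct ends) ¬centre =
  cases (add p~p′) (add r~r′) distinct (All.map end ends)
  where
  end : ∀ {x} → H [ c ~ x ] → G [ c ~ x ]
  end c~x with add c~x
  ... | inj₁ g                = g
  ... | inj₂ (inj₁ (c≡u , _)) = contradiction c≡u c≢u
  ... | inj₂ (inj₂ (c≡v , _)) = contradiction c≡v c≢v
  q+4≤′ : q + 4 ≤ deg G c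
  q+4≤′ = ≤-trans q+4≤ (sum-mono (λ x → χ-mono (H [ c ~? x ]) (G [ c ~? x ]) end))
  cases : G [ p ~ p′ ] ⊎ (p ≡ u × p′ ≡ v) ⊎ (p ≡ v × p′ ≡ u) →
          G [ r ~ r′ ] ⊎ (r ≡ u × r′ ≡ v) ⊎ (r ≡ v × r′ ≡ u) →
          Unique (p ∷ p′ ∷ r ∷ r′ ∷ []) → All (G [ c ~_]) (p ∷ p′ ∷ r ∷ r′ ∷ []) → Through q G u v
  cases (inj₁ g) (inj₁ h) uniq es = contradiction (q+4≤′ , twoEdges g h uniq es) ¬centre
  cases (inj₂ (inj₁ (refl , refl))) (inj₁ h) ((_ ∷ a ∷ b ∷ []) ∷ (c′ ∷ d ∷ []) ∷ _) (e₁ ∷ e₂ ∷ e₃ ∷ e₄ ∷ []) =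
    c , q+4≤′ , e₁ , e₂ , r , r′ , e₃ , e₄ , h , (≢-sym a , ≢-sym c′) , (≢-sym b , ≢-sym d)
  cases (inj₂ (inj₂ (refl , refl))) (inj₁ h) ((_ ∷ a ∷ b ∷ []) ∷ (c′ ∷ d ∷ []) ∷ _) (e₁ ∷ e₂ ∷ e₃ ∷ e₄ ∷ []) =
    c , q+4≤′ , e₂ , e₁ , r , r′ , e₃ , e₄ , h , (≢-sym c′ , ≢-sym a) , (≢-sym d , ≢-sym b)
  cases (inj₁ h) (inj₂ (inj₁ (refl , refl))) ((_ ∷ a ∷ b ∷ []) ∷ (c′ ∷ d ∷ []) ∷ _) (e₁ ∷ e₂ ∷ e₃ ∷ e₄ ∷ []) =
    c , q+4≤′ , e₃ , e₄ , p , p′ , e₁ , e₂ , h , (a , b) , (c′ , d)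
  cases (inj₁ h) (inj₂ (inj₂ (refl , refl))) ((_ ∷ a ∷ b ∷ []) ∷ (c′ ∷ d ∷ []) ∷ _) (e₁ ∷ e₂ ∷ e₃ ∷ e₄ ∷ []) =
    c , q+4≤′ , e₄ , e₃ , p , p′ , e₁ , e₂ , h , (b , a) , (d , c′)
  cases (inj₂ (inj₁ (refl , refl))) (inj₂ (inj₁ (refl , refl))) ((_ ∷ a ∷ _ ∷ []) ∷ _) _ = contradiction refl a
  cases (inj₂ (inj₁ (refl , refl))) (inj₂ (inj₂ (refl , refl))) ((_ ∷ _ ∷ b ∷ []) ∷ _) _ = contradiction refl b
  cases (inj₂ (inj₂ (refl , refl))) (inj₂ (inj₁ (refl , refl))) ((_ ∷ _ ∷ b ∷ []) ∷ _) _ = contradiction refl b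
  cases (inj₂ (inj₂ (refl , refl))) (inj₂ (inj₂ (refl , refl))) ((_ ∷ a ∷ _ ∷ []) ∷ _) _ = contradiction refl a

-- The three outcomes correspond to the centre in `G + uv` being neither end, `u`, or `v`. All
-- degree bounds below start from this trichotomy.
nonadjacent : {G : Graph (Fin n)} → Saturated (Fan q) G → ∀ {u v} → u ≢ v → ¬ G [ u ~ v ] →
              Through q G u v ⊎ At q G u v ⊎ At q G v u
nonadjacent {n} {q} {G} (free , sat) {u} {v} u≢v u≁v with ⊑⇒centre (sat u v (u≢v , u≁v))
... | c , centre with c ≟ u | c ≟ v
... | yes refl | _        = inj₂ (inj₁ (centre-at-end {G = G} {H = addEdge G u≢v} id u≢v centre))
... | no _     | yes refl = inj₂ (inj₂ (centre-at-end {G = G} {H = addEdge G u≢v}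
  (λ { (inj₁ g) → inj₁ g ; (inj₂ (inj₁ e)) → inj₂ (inj₂ e) ; (inj₂ (inj₂ e)) → inj₂ (inj₁ e) })
  (≢-sym u≢v) centre))
... | no c≢u   | no c≢v   =
  inj₁ (centre-off-ends {G = G} {H = addEdge G u≢v} id c≢u c≢v centre (free ∘ centre⇒⊑ {c = c}))

-- Arithmetic of the degree-sum bounds.

-- Cancellation without subtraction: `c` is common to both sides and `s` is the surplus. Each bound
-- below names its `c` and `s` and leaves two polynomial identities to the solver.
by-slack : ∀ c s {A B L R} → L ≤ R → L ≡ A + s + c → R ≡ B + c → A ≤ B
by-slack c s {A} {B} L≤R refl refl = m+n≤o⇒m≤o A (+-cancelʳ-≤ c (A + s) B L≤R)

isolated-bound : ∀ {n S} → 6 ≤ n → n * 4 ≤ S + 4 → 2 * n + 5 ≤ S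
isolated-bound 6≤n h with m≤n⇒∃[o]m+o≡n 6≤n
... | k , refl = by-slack 4 (3 + 2 * k) h
      (solve 1 (λ k → (con 6 :+ k) :* con 4
                   := con 2 :* (con 6 :+ k) :+ con 5 :+ (con 3 :+ con 2 :* k) :+ con 4) refl k) refl

-- In the application to a leaf with neighbour `w` and a vertex `r` outside `N[w]`, `N` and `D` are
-- the degrees of `w` and `r`, and `M` counts the non-neighbours of `w`, including `w`. The 6 is the
-- weight 3 at each of `w` and `r`, replaced there by the true degrees.
two-far-bound : ∀ {N D M n S} → N + M ≡ n → 4 ≤ D → 3 ≤ M →
                N + D + 3 * M + (N + (D + 0)) ≤ S + 6 → 2 * n + 5 ≤ S
two-far-bound {N} refl 4≤D 3≤M h with m≤n⇒∃[o]m+o≡n 4≤D | m≤n⇒∃[o]m+o≡n 3≤M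
... | d , refl | m , refl = by-slack 6 (m + 2 * d) h
      (solve 3 (λ N d m → N :+ (con 4 :+ d) :+ con 3 :* (con 3 :+ m) :+ (N :+ ((con 4 :+ d) :+ con 0))
                       := con 2 :* (N :+ (con 3 :+ m)) :+ con 5 :+ (m :+ con 2 :* d) :+ con 6) refl N d m) refl

-- With only `2 ≤ M` available, the missing unit comes from a third vertex of degree `A`, at least 3
-- but of weight 2; hence 8 is `3 + 3 + 2`.
one-far-bound : ∀ {N D A M n S} → N + M ≡ n → 4 ≤ D → 3 ≤ A → 2 ≤ M →
                N + D + 3 * M + (N + (D + (A + 0))) ≤ S + 8 → 2 * n + 5 ≤ S
one-far-bound {N} refl 4≤D 3≤A 2≤M h with m≤n⇒∃[o]m+o≡n 4≤D | m≤n⇒∃[o]m+o≡n 3≤A | m≤n⇒∃[o]m+o≡n 2≤M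
... | d , refl | a , refl | m , refl = by-slack 8 (m + 2 * d + a) h
      (solve 4 (λ N d a m → N :+ (con 4 :+ d) :+ con 3 :* (con 2 :+ m)
                            :+ (N :+ ((con 4 :+ d) :+ ((con 3 :+ a) :+ con 0)))
                         := con 2 :* (N :+ (con 2 :+ m)) :+ con 5 :+ (m :+ con 2 :* d :+ a) :+ con 8) refl N d a m) refl

hub-bound : ∀ {n S a b} → 5 ≤ a → 4 ≤ b → n * 2 + (a + (b + 0)) ≤ S + 4 → 2 * n + 5 ≤ S
hub-bound {n} 5≤a 4≤b h with m≤n⇒∃[o]m+o≡n 5≤a | m≤n⇒∃[o]m+o≡n 4≤b
... | a , refl | b , refl = by-slack 4 (a + b) h
      (solve 3 (λ n a b → n :* con 2 :+ ((con 5 :+ a) :+ ((con 4 :+ b) :+ con 0))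
                       := con 2 :* n :+ con 5 :+ (a :+ b) :+ con 4) refl n a b) refl

-- With degree 2 elsewhere, a vertex of degree at least `n - 1` and two of degree sum at least
-- `n + 1` give at least `4n - 6`, which exceeds `2n + 5` once `n` is at least 6.
dominating-bound : ∀ {n S w a b} → 6 ≤ n → n ≤ w + 1 → n * 1 + 2 ≤ a + b + 1 →
                   n * 2 + (w + (a + (b + 0))) ≤ S + 6 → 2 * n + 5 ≤ S
dominating-bound {S = S} {w} {a} {b} 6≤n h₁ h₂ h₃ with m≤n⇒∃[o]m+o≡n 6≤n
... | k , refl = by-slack (8 + w + a + b) (1 + 2 * k) (+-mono-≤ h₃ (+-mono-≤ h₁ h₂))
      (solve 4 (λ k w a b → (con 6 :+ k) :* con 2 :+ (w :+ (a :+ (b :+ con 0)))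
                            :+ ((con 6 :+ k) :+ ((con 6 :+ k) :* con 1 :+ con 2))
                         := con 2 :* (con 6 :+ k) :+ con 5 :+ (con 1 :+ con 2 :* k)
                            :+ (con 8 :+ w :+ a :+ b)) refl k w a b)
      (solve 4 (λ S w a b → S :+ con 6 :+ ((w :+ con 1) :+ (a :+ b :+ con 1))
                         := S :+ (con 8 :+ w :+ a :+ b)) refl S w a b)

few-big-bound : ∀ {n S} → 6 ≤ n → n * 3 ≤ S → 2 * n + 5 ≤ S
few-big-bound {S = S} 6≤n h with m≤n⇒∃[o]m+o≡n 6≤n
... | k , refl = by-slack 0 (1 + k) h
      (solve 1 (λ k → (con 6 :+ k) :* con 3
                   := con 2 :* (con 6 :+ k) :+ con 5 :+ (con 1 :+ k) :+ con 0) refl k) (sym (+-identityʳ S))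

three-big-bound : ∀ {n S a b c} → 4 ≤ a → 4 ≤ b → 4 ≤ c → n * 2 + (a + (b + (c + 0))) ≤ S + 6 → 2 * n + 5 ≤ S
three-big-bound {n} 4≤a 4≤b 4≤c h with m≤n⇒∃[o]m+o≡n 4≤a | m≤n⇒∃[o]m+o≡n 4≤b | m≤n⇒∃[o]m+o≡n 4≤c
... | a , refl | b , refl | c , refl = by-slack 6 (1 + a + b + c) h
      (solve 4 (λ n a b c → n :* con 2 :+ ((con 4 :+ a) :+ ((con 4 :+ b) :+ ((con 4 :+ c) :+ con 0)))
                         := con 2 :* n :+ con 5 :+ (con 1 :+ a :+ b :+ c) :+ con 6) refl n a b c) refl

-- The extremal structure and finite search.

-- The extremal graph described inside `G`, with the leaves at `corner zero`. Distinctness of the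
-- corners follows from `clique` by irreflexivity, and `confined` speaks of one end since adjacency
-- is symmetric.
record K4Plus (G : Graph (Fin n)) : Set where
  field
    corner     : Fin 4 → Fin n
    clique     : ∀ {i j} → i ≢ j → G [ corner i ~ corner j ]
    dominating : ∀ {x} → x ≢ corner zero → G [ corner zero ~ x ]
    confined   : ∀ {x y} → G [ x ~ y ] → x ≢ corner zero → y ≢ corner zero → ∃ λ i → x ≡ corner i

search : {A B : Fin n → Set} → (∀ x → A x ⊎ B x) → ∃ A ⊎ (∀ x → B x)
search {zero}  _ = inj₂ λ ()
search {suc n} choose with choose zero | search (choose ∘ suc)
... | inj₁ a | _              = inj₁ (zero , a)
... | inj₂ _ | inj₁ (x , a)   = inj₁ (suc x , a)
... | inj₂ b | inj₂ bs        = inj₂ λ { zero → b ; (suc x) → bs x }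

sumOver-const : ∀ k (ys : List (Fin n)) → sumOver (λ _ → k) ys ≡ length ys * k
sumOver-const k []       = refl
sumOver-const k (y ∷ ys) = cong (k +_) (sumOver-const k ys)

count-cofinite : {P : Fin n → Set} (P? : Decidable P) {ys : List (Fin n)} → Unique ys →
                 (∀ x → x ∉ ys → P x) → n ≤ count P? + length ys
count-cofinite {n} P? {ys} ys! Px = begin
  n                                                        ≡⟨ trans (sum-const n 1) (*-identityʳ n) ⟨
  sum {n} (λ _ → 1)                                        ≤⟨ m≤m+n _ _ ⟩
  sum {n} (λ _ → 1) + sumOver (λ x → χ (P? x)) ys          ≤⟨ exchange _ _ ys!
                                                                (λ x x∉ → ≤-reflexive (sym (χ-true (P? x) (Px x x∉)))) ⟩
  count P? + sumOver (λ _ → 1) ys                          ≡⟨ cong (count P? +_)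
                                                                (trans (sumOver-const 1 ys) (*-identityʳ _)) ⟩
  count P? + length ys                                     ∎
  where open ≤-Reasoning

fresh : {ys : List (Fin n)} → Unique ys → suc (length ys) ≤ n → ∃ λ x → x ∉ ys
fresh {n} {ys} ys! len< with any? (λ x → ¬? (x ∈? ys))
... | yes found = found
-- If `ys` exhausts the vertices, even the empty predicate holds off `ys`, which forces
-- `n ≤ length ys`.
... | no none   = contradiction (≤-trans len< (≤-trans
        (count-cofinite {P = λ _ → ⊥} (λ _ → no id) ys! (λ x x∉ → none (x , x∉)))
        (≤-reflexive (cong (_+ length ys) (sum-replicate-zero n))))) (<-irrefl refl)

pigeonhole-pair : ∀ {a b p p′ r : Fin n} → p ≢ p′ → p ≢ r → p′ ≢ r →
  p ≡ a ⊎ p ≡ b → p′ ≡ a ⊎ p′ ≡ b → r ≡ a ⊎ r ≡ b → ⊥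
pigeonhole-pair p≢p′ p≢r p′≢r (inj₁ refl) (inj₁ refl) _           = p≢p′ refl
pigeonhole-pair p≢p′ p≢r p′≢r (inj₂ refl) (inj₂ refl) _           = p≢p′ refl
pigeonhole-pair p≢p′ p≢r p′≢r (inj₁ refl) (inj₂ refl) (inj₁ refl) = p≢r refl
pigeonhole-pair p≢p′ p≢r p′≢r (inj₁ refl) (inj₂ refl) (inj₂ refl) = p′≢r refl
pigeonhole-pair p≢p′ p≢r p′≢r (inj₂ refl) (inj₁ refl) (inj₁ refl) = p′≢r refl
pigeonhole-pair p≢p′ p≢r p′≢r (inj₂ refl) (inj₁ refl) (inj₂ refl) = p≢r refl

-- The edges are disjoint, so `t` lies on at most one of them.
edge-avoiding : {G : Graph (Fin n)} {P : Fin n → Set} (t : Fin n) → TwoEdges G P →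
  Σ[ y ∈ Fin n ] Σ[ z ∈ Fin n ] (G [ y ~ z ] × (P y × P z) × (y ≢ t × z ≢ t))
edge-avoiding t (twoEdges {p} {p′} {r} {r′} p~p′ r~r′
  ((_ ∷ p≢r ∷ p≢r′ ∷ []) ∷ (p′≢r ∷ p′≢r′ ∷ []) ∷ _) (Pp ∷ Pp′ ∷ Pr ∷ Pr′ ∷ []))
  with p ≟ t | p′ ≟ t
... | yes refl | _        = r , r′ , r~r′ , (Pr , Pr′) , (≢-sym p≢r , ≢-sym p≢r′)
... | no _     | yes refl = r , r′ , r~r′ , (Pr , Pr′) , (≢-sym p′≢r , ≢-sym p′≢r′)
... | no p≢t   | no p′≢t  = p , p′ , p~p′ , (Pp , Pp′) , (p≢t , p′≢t)

-- Saturated graphs and their dominating vertices.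

module SaturatedGraph (G : Graph (Fin n)) (sat : Saturated (Fan q) G)
                      (1≤q : 1 ≤ q) (q+5≤n : q + 5 ≤ n) where

  infix 4 _∼_
  _∼_ : Fin n → Fin n → Set
  u ∼ v = G [ u ~ v ]

  ~-sym : ∀ {u v} → u ∼ v → v ∼ u
  ~-sym = Graph.symm G

  ~⇒≢ : ∀ {u v} → u ∼ v → u ≢ v
  ~⇒≢ = adjacent⇒≢ G

  total : ℕ
  total = sum (deg G)

  6≤n : 6 ≤ n
  6≤n = ≤-trans (+-monoˡ-≤ 5 1≤q) q+5≤n

  4≤q+3 : 4 ≤ q + 3
  4≤q+3 = +-monoˡ-≤ 3 1≤q

  5≤q+4 : 5 ≤ q + 4
  5≤q+4 = +-monoˡ-≤ 4 1≤q

  Dominating : Fin n → Set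
  Dominating w = ∀ x → x ≢ w → w ∼ x

  far? : ∀ w → Dec (∃ λ r → r ≢ w × ¬ w ∼ r)
  far? w = any? (λ r → ¬? (r ≟ w) ×-dec ¬? (G [ w ~? r ]))

  ¬far⇒dominating : ∀ {w} → ¬ (∃ λ r → r ≢ w × ¬ w ∼ r) → Dominating w
  ¬far⇒dominating {w} none x x≢w = decidable-stable (G [ w ~? x ]) (λ w≁x → none (x , x≢w , w≁x))

  -- A dominating vertex has degree `n - 1`, at least `q + 4`, so two disjoint edges avoiding it
  -- would make it a centre.
  dominating⇒¬twoEdges : ∀ {w} → Dominating w → ¬ TwoEdges G (_≢ w)
  dominating⇒¬twoEdges {w} dom two =
    proj₁ sat (centre⇒⊑ {c = w} (q+4≤deg , mapTwoEdges {H = G} (λ _ _ → id) (dom _) two))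
    where
    n≤deg+1 : n ≤ deg G w + 1
    n≤deg+1 = count-cofinite (G [ w ~?_]) {w ∷ []} ([] ∷ []) (λ x x∉ → dom x (x∉ ∘ here))
    q+4≤deg : q + 4 ≤ deg G w
    q+4≤deg = +-cancelʳ-≤ 1 (q + 4) (deg G w) (≤-trans (≤-reflexive (+-assoc q 4 1)) (≤-trans q+5≤n n≤deg+1))

  dominating⇒edges-meet : ∀ {w} → Dominating w → ∀ {a b y z} → a ∼ b → y ∼ z →
    a ≢ w → b ≢ w → y ≢ w → z ≢ w → a ≢ y → a ≢ z → b ≢ y → b ≢ z → ⊥
  dominating⇒edges-meet dom a~b y~z a≢w b≢w y≢w z≢w a≢y a≢z b≢y b≢z =
    dominating⇒¬twoEdges dom (twoEdges a~b y~z
      ((~⇒≢ a~b ∷ a≢y ∷ a≢z ∷ []) ∷ (b≢y ∷ b≢z ∷ []) ∷ (~⇒≢ y~z ∷ []) ∷ [] ∷ [])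
      (a≢w ∷ b≢w ∷ y≢w ∷ z≢w ∷ []))

  -- Classification by number of neighbours; isolated vertices.

  Isolated : Fin n → Set
  Isolated v = ∀ x → ¬ v ∼ x

  Leaf : Fin n → Fin n → Set
  Leaf v w = v ∼ w × (∀ x → v ∼ x → x ≡ w)

  TwoNeighbours : Fin n → Set
  TwoNeighbours v = Σ[ x ∈ Fin n ] Σ[ y ∈ Fin n ] (v ∼ x × v ∼ y × x ≢ y)

  classify : ∀ v → (Isolated v ⊎ ∃ (Leaf v)) ⊎ TwoNeighbours v
  classify v with any? (G [ v ~?_])
  ... | no none = inj₁ (inj₁ λ x v~x → none (x , v~x))
  ... | yes (w , v~w) with any? (λ x → (G [ v ~? x ]) ×-dec ¬? (x ≟ w))
  ...   | no none = inj₁ (inj₂ (w , v~w , λ x v~x → decidable-stable (x ≟ w) λ x≢w → none (x , v~x , x≢w)))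
  ...   | yes (x , v~x , x≢w) = inj₂ (x , w , v~x , v~w , x≢w)

  -- Join `v` to any other `x`. The vertex `v` has no common neighbour with `x`, and as a centre it
  -- would have only `x` available as an end. So `x` is the centre and has degree at least `q + 3`.
  isolated⇒large : ∀ {v} → Isolated v → 2 * n + 5 ≤ total
  isolated⇒large {v} iso = isolated-bound 6≤n
      (subst (_≤ total + 4) (sum-const n 4) (≤-trans (m≤m+n _ _)
        (exchange (deg G) (λ _ → 4) {v ∷ []} ([] ∷ []) (λ x x∉ → 4≤deg x (x∉ ∘ here)))))
    where
    4≤deg : ∀ x → x ≢ v → 4 ≤ deg G x
    4≤deg x x≢v with nonadjacent {G = G} sat x≢v (iso x ∘ ~-sym)
    ... | inj₁ (c , _ , _ , c~v , _) = contradiction (~-sym c~v) (iso c)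
    ... | inj₂ (inj₁ (q+3≤ , _)) = ≤-trans 4≤q+3 q+3≤
    ... | inj₂ (inj₂ (_ , twoEdges p~p′ _ _ (inj₁ v~p ∷ _))) = contradiction v~p (iso _)
    ... | inj₂ (inj₂ (_ , twoEdges p~p′ _ _ (inj₂ _ ∷ inj₁ v~p′ ∷ _))) = contradiction v~p′ (iso _)
    ... | inj₂ (inj₂ (_ , twoEdges p~p′ _ _ (inj₂ refl ∷ inj₂ refl ∷ _))) = contradiction refl (~⇒≢ p~p′)

  -- Graphs with a leaf.

  module _ {v w : Fin n} (leaf : Leaf v w) where

    -- The four distinct ends would all lie in the pair `w`, `x`.
    ¬At-leaf : ∀ {x} → ¬ At q G v x
    ¬At-leaf (_ , twoEdges _ _ ((p≢p′ ∷ p≢r ∷ _) ∷ (p′≢r ∷ _) ∷ _) (Pp ∷ Pp′ ∷ Pr ∷ _)) =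
      pigeonhole-pair p≢p′ p≢r p′≢r (end Pp) (end Pp′) (end Pr)
      where
      end : ∀ {x y} → v ∼ y ⊎ y ≡ x → y ≡ w ⊎ y ≡ x
      end (inj₁ v~y) = inj₁ (proj₂ leaf _ v~y)
      end (inj₂ eq)  = inj₂ eq

    -- A common neighbour of `v` and `r` would have to be `w`, which misses `r`, and the leaf `v`
    -- cannot be the centre.
    far⇒At : ∀ {r} → r ≢ w → ¬ w ∼ r → At q G r v
    far⇒At {r} r≢w w≁r with nonadjacent {G = G} sat r≢v (r≢w ∘ proj₂ leaf r ∘ ~-sym)
      where
      r≢v : r ≢ v
      r≢v refl = w≁r (~-sym (proj₁ leaf))
    ... | inj₁ (c , _ , c~r , c~v , _) = contradiction (subst (_∼ r) (proj₂ leaf c (~-sym c~v)) c~r) w≁r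
    ... | inj₂ (inj₁ at) = at
    ... | inj₂ (inj₂ at) = contradiction at ¬At-leaf

    -- The weight `g` bounds the degrees away from `w` and sums to `N + D + 3 * M` with `N + M = n`.
    -- A second vertex `r′` outside `N[w]` gives `3 ≤ M`. Otherwise the two edges at `r` contain an
    -- edge `ab` avoiding `v`; its ends are adjacent to both `w` and `r`, so `a` has degree at least
    -- 3, above its weight 2.
    far⇒large : ∀ {r} → r ≢ w → ¬ w ∼ r → 2 * n + 5 ≤ total
    far⇒large {r} r≢w w≁r = by-cases (any? (λ x → (¬? (x ≟ w) ×-dec ¬? (G [ w ~? x ])) ×-dec ¬? (x ≟ r)))
      where
      f g : Fin n → ℕ
      f = deg G
      -- Vertices of N(w) have degree at least 1, or 2 if they are also adjacent to r;
      -- the remaining ones have degree at least 4.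
      g x = χ (G [ w ~? x ]) + χ (G [ r ~? x ]) + 3 * χ (¬? (G [ w ~? x ]))
      N D M : ℕ
      N = deg G w
      D = deg G r
      M = count (λ x → ¬? (G [ w ~? x ]))
      N+M≡n : N + M ≡ n
      N+M≡n = trans (sym (∑-distrib-+ (λ x → χ (G [ w ~? x ])) _))
                (trans (sum-cong-≗ (λ x → χ-¬ (G [ w ~? x ]))) (trans (sum-const n 1) (*-identityʳ n)))
      sum-g : sum g ≡ N + D + 3 * M
      sum-g = trans (∑-distrib-+ (λ x → χ (G [ w ~? x ]) + χ (G [ r ~? x ])) _)
                (cong₂ _+_ (∑-distrib-+ (λ x → χ (G [ w ~? x ])) _) (sum-scale 3 (λ x → χ (¬? (G [ w ~? x ])))))
      4≤far : ∀ {x} → x ≢ w → ¬ w ∼ x → 4 ≤ f x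
      4≤far x≢w w≁x = ≤-trans 4≤q+3 (proj₁ (far⇒At x≢w w≁x))
      r≁w : ¬ r ∼ w
      r≁w = w≁r ∘ ~-sym
      g≡ : ∀ {x i j} → χ (G [ w ~? x ]) ≡ i → χ (G [ r ~? x ]) ≡ j → g x ≡ i + j + 3 * (1 ∸ i)
      g≡ {x} {i} wi rj = cong₂ _+_ (cong₂ _+_ wi rj) (cong (3 *_) (trans (sym (m+n∸m≡n (χ (G [ w ~? x ])) _))
        (cong₂ _∸_ (χ-¬ (G [ w ~? x ])) wi)))
      gw≡3 : g w ≡ 3
      gw≡3 = g≡ (χ-false (G [ w ~? w ]) (λ e → ~⇒≢ e refl)) (χ-false (G [ r ~? w ]) r≁w)
      gr≡3 : g r ≡ 3
      gr≡3 = g≡ (χ-false (G [ w ~? r ]) w≁r) (χ-false (G [ r ~? r ]) (λ e → ~⇒≢ e refl))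
      g≤f : ∀ x → x ≢ w → g x ≤ f x
      g≤f x x≢w with G [ w ~? x ] | G [ r ~? x ]
      ... | yes w~x | yes r~x =
        length≤count (G [ x ~?_]) {w ∷ r ∷ []} ((≢-sym r≢w ∷ []) ∷ [] ∷ []) (~-sym w~x ∷ ~-sym r~x ∷ [])
      ... | yes w~x | no _    = length≤count (G [ x ~?_]) {w ∷ []} ([] ∷ []) (~-sym w~x ∷ [])
      ... | no w≁x  | yes _   = 4≤far x≢w w≁x
      ... | no w≁x  | no _    = ≤-trans (s≤s (s≤s (s≤s z≤n))) (4≤far x≢w w≁x)
      4≤D : 4 ≤ D
      4≤D = 4≤far r≢w w≁r
      w≁w : ¬ w ∼ w
      w≁w e = ~⇒≢ e refl
      by-cases : Dec (∃ λ x → (x ≢ w × ¬ w ∼ x) × x ≢ r) → 2 * n + 5 ≤ total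
      by-cases (yes (r′ , (r′≢w , w≁r′) , r′≢r)) = two-far-bound N+M≡n 4≤D
        (length≤count (λ x → ¬? (G [ w ~? x ])) {w ∷ r ∷ r′ ∷ []}
          ((≢-sym r≢w ∷ ≢-sym r′≢w ∷ []) ∷ (≢-sym r′≢r ∷ []) ∷ [] ∷ []) (w≁w ∷ w≁r ∷ w≁r′ ∷ []))
        (subst₂ _≤_ (cong (_+ (N + (D + 0))) sum-g) (cong (total +_) (cong₂ _+_ gw≡3 (cong (_+ 0) gr≡3)))
          (exchange f g {w ∷ r ∷ []} ((≢-sym r≢w ∷ []) ∷ [] ∷ []) (λ x x∉ → g≤f x (x∉ ∘ here))))
      by-cases (no none) with edge-avoiding {G = G} v (proj₂ (far⇒At r≢w w≁r))
      ... | a , b , a~b , (Pa , Pb) , (a≢v , b≢v) = one-far-bound N+M≡n 4≤D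
        (length≤count (G [ a ~?_]) {w ∷ r ∷ b ∷ []}
          ((≢-sym r≢w ∷ ~⇒≢ w~b ∷ []) ∷ (~⇒≢ r~b ∷ []) ∷ [] ∷ []) (~-sym w~a ∷ ~-sym r~a ∷ a~b ∷ []))
        (length≤count (λ x → ¬? (G [ w ~? x ])) {w ∷ r ∷ []} ((≢-sym r≢w ∷ []) ∷ [] ∷ []) (w≁w ∷ w≁r ∷ []))
        (subst₂ _≤_ (cong (_+ (N + (D + (deg G a + 0)))) sum-g)
          (cong (total +_) (cong₂ _+_ gw≡3 (cong₂ _+_ gr≡3 (cong (_+ 0) ga≡2))))
          (exchange f g {w ∷ r ∷ a ∷ []} ((≢-sym r≢w ∷ ~⇒≢ w~a ∷ []) ∷ (~⇒≢ r~a ∷ []) ∷ [] ∷ [])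
            (λ x x∉ → g≤f x (x∉ ∘ here))))
        where
        near-r : ∀ {x} → r ∼ x ⊎ x ≡ v → x ≢ v → r ∼ x
        near-r (inj₁ r~x) _   = r~x
        near-r (inj₂ x≡v) x≢v = contradiction x≡v x≢v
        r~a : r ∼ a
        r~a = near-r Pa a≢v
        r~b : r ∼ b
        r~b = near-r Pb b≢v
        near-w : ∀ {x} → r ∼ x → w ∼ x
        -- In this case `r` is the only vertex other than `w` that `w` misses.
        near-w {x} r~x = decidable-stable (G [ w ~? x ]) λ w≁x →
          none (x , ((λ { refl → r≁w r~x }) , w≁x) , ≢-sym (~⇒≢ r~x))
        w~a : w ∼ a
        w~a = near-w r~a
        w~b : w ∼ b
        w~b = near-w r~b
        ga≡2 : g a ≡ 2
        ga≡2 = g≡ (χ-true (G [ w ~? a ]) w~a) (χ-true (G [ r ~? a ]) r~a)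

    module _ (dom : Dominating w) where

      -- This shows that the edges avoiding `w` have no common vertex. Join `v` to `x`: if the
      -- centre is a common neighbour, it is `w`, and its second edge avoids `x`. If the centre is
      -- `x`, one of its two edges avoids `w`, and that edge cannot end at `v`, whose only neighbour
      -- is `w`.
      other-edge : ∀ {x} → x ≢ v → x ≢ w →
        Σ[ y ∈ Fin n ] Σ[ z ∈ Fin n ] (y ∼ z × (y ≢ w × z ≢ w) × (y ≢ x × z ≢ x))
      other-edge {x} x≢v x≢w with nonadjacent {G = G} sat x≢v (x≢w ∘ proj₂ leaf x ∘ ~-sym)
      ... | inj₁ (c , _ , _ , c~v , y , z , c~y , c~z , y~z , (y≢x , _) , (z≢x , _))
              with proj₂ leaf c (~-sym c~v)
      ...     | refl = y , z , y~z , (≢-sym (~⇒≢ c~y) , ≢-sym (~⇒≢ c~z)) , (y≢x , z≢x)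
      other-edge {x} x≢v x≢w | inj₂ (inj₂ at) = contradiction at ¬At-leaf
      other-edge {x} x≢v x≢w | inj₂ (inj₁ (_ , two)) with edge-avoiding {G = G} w two
      ... | y , z , y~z , (inj₁ x~y , inj₁ x~z) , away = y , z , y~z , away , (≢-sym (~⇒≢ x~y) , ≢-sym (~⇒≢ x~z))
      ... | y , z , y~z , (inj₂ refl , _) , (_ , z≢w) = contradiction (proj₂ leaf z y~z) z≢w
      ... | y , z , y~z , (inj₁ _ , inj₂ refl) , (y≢w , _) = contradiction (proj₂ leaf y (~-sym y~z)) y≢w

      edge⇒≢leaf : ∀ {a b} → a ∼ b → b ≢ w → a ≢ v
      edge⇒≢leaf a~b b≢w refl = b≢w (proj₂ leaf _ a~b)

      -- Some edge avoids both `w` and `a`. Edges avoiding `w` pairwise meet, so it meets `ab`,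
      -- necessarily at `b`.
      extend-path : ∀ {a b} → a ∼ b → a ≢ w → b ≢ w → ∃ λ c → b ∼ c × c ≢ a × c ≢ w
      extend-path {a} {b} a~b a≢w b≢w with other-edge (edge⇒≢leaf a~b b≢w) a≢w
      ... | y , z , y~z , (y≢w , z≢w) , (y≢a , z≢a) with b ≟ y | b ≟ z
      ...   | yes refl | _        = z , y~z , z≢a , z≢w
      ...   | no _     | yes refl = y , ~-sym y~z , y≢a , y≢w
      ...   | no b≢y   | no b≢z   =
        ⊥-elim (dominating⇒edges-meet dom a~b y~z a≢w b≢w y≢w z≢w (≢-sym y≢a) (≢-sym z≢a) b≢y b≢z)

      triangle⇒K4Plus : ∀ {a b c} → a ∼ b → b ∼ c → a ∼ c → a ≢ w → b ≢ w → c ≢ w → K4Plus G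
      triangle⇒K4Plus {a} {b} {c} a~b b~c a~c a≢w b≢w c≢w = record
        { corner = corner ; clique = clique _ _ ; dominating = dom _ ; confined = confined }
        where
        corner : Fin 4 → Fin n
        corner zero                   = w
        corner (suc zero)             = a
        corner (suc (suc zero))       = b
        corner (suc (suc (suc zero))) = c
        clique : ∀ i j → i ≢ j → corner i ∼ corner j
        clique zero zero ne = contradiction refl ne
        clique zero (suc zero) _ = dom a a≢w
        clique zero (suc (suc zero)) _ = dom b b≢w
        clique zero (suc (suc (suc zero))) _ = dom c c≢w
        clique (suc zero) zero _ = ~-sym (dom a a≢w)
        clique (suc zero) (suc zero) ne = contradiction refl ne
        clique (suc zero) (suc (suc zero)) _ = a~b
        clique (suc zero) (suc (suc (suc zero))) _ = a~c
        clique (suc (suc zero)) zero _ = ~-sym (dom b b≢w)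
        clique (suc (suc zero)) (suc zero) _ = ~-sym a~b
        clique (suc (suc zero)) (suc (suc zero)) ne = contradiction refl ne
        clique (suc (suc zero)) (suc (suc (suc zero))) _ = b~c
        clique (suc (suc (suc zero))) zero _ = ~-sym (dom c c≢w)
        clique (suc (suc (suc zero))) (suc zero) _ = ~-sym a~c
        clique (suc (suc (suc zero))) (suc (suc zero)) _ = ~-sym b~c
        clique (suc (suc (suc zero))) (suc (suc (suc zero))) ne = contradiction refl ne
        confined : ∀ {x y} → x ∼ y → x ≢ w → y ≢ w → ∃ λ i → x ≡ corner i
        confined {x} {y} x~y x≢w y≢w with x ≟ a | x ≟ b | x ≟ c
        ... | yes eq | _      | _      = suc zero , eq
        ... | no _   | yes eq | _      = suc (suc zero) , eq
        ... | no _   | no _   | yes eq = suc (suc (suc zero)) , eq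
        -- An edge `xy` with `x` off the triangle misses a side: the one opposite `y` if `y` is a
        -- corner, and `ab` also if `y` is off the triangle.
        ... | no x≢a | no x≢b | no x≢c with y ≟ a | y ≟ b
        ...   | yes refl | _ = ⊥-elim (dominating⇒edges-meet dom b~c x~y b≢w c≢w x≢w y≢w
                                 (≢-sym x≢b) (≢-sym (~⇒≢ a~b)) (≢-sym x≢c) (≢-sym (~⇒≢ a~c)))
        ...   | no _ | yes refl = ⊥-elim (dominating⇒edges-meet dom a~c x~y a≢w c≢w x≢w y≢w
                                 (≢-sym x≢a) (~⇒≢ a~b) (≢-sym x≢c) (≢-sym (~⇒≢ b~c)))
        ...   | no y≢a | no y≢b = ⊥-elim (dominating⇒edges-meet dom a~b x~y a≢w b≢w x≢w y≢w
                                 (≢-sym x≢a) (≢-sym y≢a) (≢-sym x≢b) (≢-sym y≢b))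

      -- Extending `ab` at both ends gives edges `bc` and `ad` avoiding `w`. They must meet, which
      -- is only possible at `c = d`, and this closes a triangle.
      edge⇒K4Plus : ∀ {a b} → a ∼ b → a ≢ w → b ≢ w → K4Plus G
      edge⇒K4Plus {a} {b} a~b a≢w b≢w = close (extend-path a~b a≢w b≢w) (extend-path (~-sym a~b) b≢w a≢w)
        where
        close : (∃ λ c → b ∼ c × c ≢ a × c ≢ w) → (∃ λ d → a ∼ d × d ≢ b × d ≢ w) → K4Plus G
        close (c , b~c , c≢a , c≢w) (d , a~d , d≢b , d≢w) with c ≟ d
        ... | yes refl = triangle⇒K4Plus a~b b~c a~d a≢w b≢w c≢w
        ... | no c≢d   = ⊥-elim (dominating⇒edges-meet dom b~c a~d b≢w c≢w a≢w d≢w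
                           (≢-sym (~⇒≢ a~b)) (≢-sym d≢b) c≢a c≢d)

      dominated-leaf⇒K4Plus : K4Plus G
      dominated-leaf⇒K4Plus
        with fresh {ys = v ∷ w ∷ []} ((~⇒≢ (proj₁ leaf) ∷ []) ∷ [] ∷ []) (≤-trans (s≤s (s≤s (s≤s z≤n))) 6≤n)
      ... | x , x∉ with other-edge (x∉ ∘ here) (x∉ ∘ there ∘ here)
      ...   | _ , _ , a~b , (a≢w , b≢w) , _ = edge⇒K4Plus a~b a≢w b≢w

    leaf⇒large : K4Plus G ⊎ 2 * n + 5 ≤ total
    leaf⇒large with far? w
    ... | yes (r , r≢w , w≁r) = inj₂ (far⇒large r≢w w≁r)
    ... | no none             = inj₁ (dominated-leaf⇒K4Plus (¬far⇒dominating none))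

  -- Minimum degree at least two.

  module _ (two : ∀ x → TwoNeighbours x) where

    2≤deg : ∀ x → 2 ≤ deg G x
    2≤deg x with two x
    ... | y , z , x~y , x~z , y≢z = length≤count (G [ x ~?_]) {y ∷ z ∷ []} ((y≢z ∷ []) ∷ [] ∷ []) (x~y ∷ x~z ∷ [])

    exchange-2 : ∀ {ys} → Unique ys → n * 2 + sumOver (deg G) ys ≤ total + length ys * 2
    exchange-2 {ys} ys! = subst₂ _≤_
      (cong (_+ sumOver (deg G) ys) (sum-const n 2)) (cong (total +_) (sumOver-const 2 ys))
      (exchange (deg G) (λ _ → 2) ys! (λ x _ → 2≤deg x))

    neighbour≢ : ∀ w x → ∃ λ y → x ∼ y × y ≢ w
    neighbour≢ w x with two x
    ... | y , z , x~y , x~z , y≢z with y ≟ w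
    ...   | yes refl = z , x~z , ≢-sym y≢z
    ...   | no y≢w   = y , x~y , y≢w

    hub⇒large : ∀ {w r} → q + 4 ≤ deg G w → r ≢ w → 4 ≤ deg G r → 2 * n + 5 ≤ total
    hub⇒large {w} {r} q+4≤ r≢w 4≤ =
      hub-bound {n} (≤-trans 5≤q+4 q+4≤) 4≤ (exchange-2 {w ∷ r ∷ []} ((≢-sym r≢w ∷ []) ∷ [] ∷ []))

    -- It suffices to find a second vertex of degree at least 4. If `r` misses some `x` other than
    -- `w` and itself, the trichotomy offers `r`, `x`, or a common neighbour, which is not `w`
    -- because `w` misses `r`. Otherwise `r` itself has degree at least `n - 2`.
    hub-far⇒large : ∀ {w r} → q + 4 ≤ deg G w → r ≢ w → ¬ w ∼ r → 2 * n + 5 ≤ total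
    hub-far⇒large {w} {r} q+4≤ r≢w w≁r with any? (λ x → ¬? (x ∈? (r ∷ w ∷ [])) ×-dec ¬? (G [ r ~? x ]))
    ... | no none = hub⇒large q+4≤ r≢w (+-cancelʳ-≤ 2 4 (deg G r) (≤-trans 6≤n
            (count-cofinite (G [ r ~?_]) ((r≢w ∷ []) ∷ [] ∷ [])
              (λ x x∉ → decidable-stable (G [ r ~? x ]) λ r≁x → none (x , x∉ , r≁x)))))
    ... | yes (x , x∉ , r≁x) with nonadjacent {G = G} sat (≢-sym (x∉ ∘ here)) r≁x
    ...   | inj₁ (c , q+4≤c , c~r , _) =
            hub⇒large {r = c} q+4≤ (λ { refl → w≁r c~r }) (≤-trans (m≤n+m 4 q) q+4≤c)
    ...   | inj₂ (inj₁ (q+3≤ , _)) = hub⇒large q+4≤ r≢w (≤-trans 4≤q+3 q+3≤)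
    ...   | inj₂ (inj₂ (q+3≤ , _)) = hub⇒large q+4≤ (x∉ ∘ there ∘ here) (≤-trans 4≤q+3 q+3≤)

    -- Fix an edge `ab` avoiding `w`. Every `x` other than `w` lies on an edge avoiding `w`, which
    -- must meet `ab`, so `x` is adjacent to `a` or `b`. As `w` is adjacent to both, the degrees of
    -- `a` and `b` sum to at least `n + 1`.
    hub-dominating⇒large : ∀ {w} → Dominating w → 2 * n + 5 ≤ total
    hub-dominating⇒large {w} dom with fresh {ys = w ∷ []} ([] ∷ []) (≤-trans (s≤s (s≤s z≤n)) 6≤n)
    ... | a , a∉ with neighbour≢ w a
    ...   | b , a~b , b≢w = dominating-bound {a = deg G a} {b = deg G b} 6≤n
              (count-cofinite (G [ w ~?_]) {w ∷ []} ([] ∷ []) (λ x x∉ → dom x (x∉ ∘ here)))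
              covered
              (exchange-2 {w ∷ a ∷ b ∷ []} ((≢-sym a≢w ∷ ≢-sym b≢w ∷ []) ∷ (~⇒≢ a~b ∷ []) ∷ [] ∷ []))
      where
      a≢w : a ≢ w
      a≢w = a∉ ∘ here
      f : Fin n → ℕ
      f x = χ (G [ a ~? x ]) + χ (G [ b ~? x ])
      f≥1 : ∀ x → x ≢ w → 1 ≤ f x
      f≥1 x x≢w with G [ a ~? x ] | G [ b ~? x ]
      ... | yes _  | _     = s≤s z≤n
      ... | no _   | yes _ = s≤s z≤n
      ... | no a≁x | no b≁x with neighbour≢ w x
      ...   | y , x~y , y≢w = ⊥-elim (dominating⇒edges-meet dom a~b x~y a≢w b≢w x≢w y≢w
                (λ { refl → b≁x (~-sym a~b) }) (λ { refl → a≁x (~-sym x~y) })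
                (λ { refl → a≁x a~b }) (λ { refl → b≁x (~-sym x~y) }))
      fw≡2 : f w ≡ 2
      fw≡2 = cong₂ _+_ (χ-true (G [ a ~? w ]) (~-sym (dom a a≢w))) (χ-true (G [ b ~? w ]) (~-sym (dom b b≢w)))
      covered : n * 1 + 2 ≤ deg G a + deg G b + 1
      covered = subst₂ _≤_ (cong₂ _+_ (sum-const n 1) (trans (+-identityʳ (f w)) fw≡2))
        (cong (_+ 1) (∑-distrib-+ (λ x → χ (G [ a ~? x ])) _))
        (exchange f (λ _ → 1) {w ∷ []} ([] ∷ []) (λ x x∉ → f≥1 x (x∉ ∘ here)))

    module _ (no-hub : ∀ c → ¬ q + 4 ≤ deg G c) where

      Big : Fin n → Set
      Big x = q + 3 ≤ deg G x

      big? : Decidable Big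
      big? x = q + 3 ≤? deg G x

      -- Without hubs, two non-adjacent vertices cannot both be small. So a small vertex misses at
      -- most itself and two big ones, and has degree at least `n - 3`; thus all degrees are at
      -- least 3.
      few-big⇒large : ∀ {ys} → Unique ys → All Big ys → length ys ≤ 2 →
                      (∀ x → x ∉ ys → ¬ Big x) → 2 * n + 5 ≤ total
      few-big⇒large {ys} ys! big-ys len≤2 small = few-big-bound 6≤n
          (subst (_≤ total) (sum-const n 3) (sum-mono 3≤deg))
        where
        3≤deg : ∀ x → 3 ≤ deg G x
        3≤deg x with big? x
        ... | yes big = ≤-trans (m≤n+m 3 q) big
        ... | no ¬big = +-cancelʳ-≤ 3 3 (deg G x) (≤-trans 6≤n (≤-trans
              (count-cofinite (G [ x ~?_]) {x ∷ ys} (All.map (λ { big refl → ¬big big }) big-ys ∷ ys!) adjacent)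
              (+-monoʳ-≤ (deg G x) (s≤s len≤2))))
          where
          adjacent : ∀ y → y ∉ x ∷ ys → x ∼ y
          adjacent y y∉ = decidable-stable (G [ x ~? y ]) λ x≁y →
            ([ (λ { (c , hub , _) → no-hub c hub }) , [ ¬big ∘ proj₁ , small y (y∉ ∘ there) ∘ proj₁ ]′ ]′
              (nonadjacent {G = G} sat (≢-sym (y∉ ∘ here)) x≁y))

      three-big⇒large : ∀ {a b c} → Unique (a ∷ b ∷ c ∷ []) → All Big (a ∷ b ∷ c ∷ []) → 2 * n + 5 ≤ total
      three-big⇒large abc! (big-a ∷ big-b ∷ big-c ∷ []) =
        three-big-bound {n} (≤-trans 4≤q+3 big-a) (≤-trans 4≤q+3 big-b) (≤-trans 4≤q+3 big-c) (exchange-2 abc!)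

      another? : ∀ ys → Dec (∃ λ x → Big x × x ∉ ys)
      another? ys = any? (λ x → big? x ×-dec ¬? (x ∈? ys))

      no-hub⇒large : 2 * n + 5 ≤ total
      no-hub⇒large with another? []
      ... | no none = few-big⇒large [] [] z≤n (λ x x∉ big → none (x , big , x∉))
      ... | yes (a , big-a , _) with another? (a ∷ [])
      ...   | no none = few-big⇒large ([] ∷ []) (big-a ∷ []) (s≤s z≤n) (λ x x∉ big → none (x , big , x∉))
      ...   | yes (b , big-b , b∉) with another? (b ∷ a ∷ [])
      ...     | no none = few-big⇒large (((b∉ ∘ here) ∷ []) ∷ [] ∷ []) (big-b ∷ big-a ∷ []) (s≤s (s≤s z≤n))
                            (λ x x∉ big → none (x , big , x∉))
      ...     | yes (c , big-c , c∉) = three-big⇒large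
                  (((c∉ ∘ here) ∷ (c∉ ∘ there ∘ here) ∷ []) ∷ ((b∉ ∘ here) ∷ []) ∷ [] ∷ [])
                  (big-c ∷ big-b ∷ big-a ∷ [])

    min-degree-2⇒large : 2 * n + 5 ≤ total
    min-degree-2⇒large with any? (λ c → q + 4 ≤? deg G c)
    ... | no none = no-hub⇒large (λ c hub → none (c , hub))
    ... | yes (w , hub) with far? w
    ...   | yes (r , r≢w , w≁r) = hub-far⇒large hub r≢w w≁r
    ...   | no none             = hub-dominating⇒large (¬far⇒dominating none)

  K4Plus⊎large : K4Plus G ⊎ 2 * n + 5 ≤ total
  K4Plus⊎large with search classify
  ... | inj₁ (v , inj₁ isolated)   = inj₂ (isolated⇒large isolated)
  ... | inj₁ (v , inj₂ (w , leaf)) = leaf⇒large leaf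
  ... | inj₂ two                   = inj₂ (min-degree-2⇒large two)

-- From the extremal structure to an isomorphism.

insert-at : ∀ {m n} (i : Fin (suc m)) (j : Fin (suc n)) (π : Permutation m n) → insert i j π ⟨$⟩ʳ i ≡ j
insert-at i j π rewrite proj₂ (dec-yes (i ≟ i) refl) = refl

-- Send `f zero` to `zero`, delete both, and recurse: by injectivity the remaining values survive
-- the deletion of `f zero`.
extend : ∀ k {m} (f : Fin k → Fin (k + m)) → Injective _≡_ _≡_ f →
         Σ[ π ∈ Permutation (k + m) (k + m) ] (∀ i → π ⟨$⟩ʳ f i ≡ i ↑ˡ m)
extend zero f f-inj = Permutation.id , λ ()
extend (suc k) {m} f f-inj = insert (f zero) zero π′ , λ { zero → insert-at (f zero) zero π′ ; (suc i) → later i }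
  where
  0≢suc : ∀ i → f zero ≢ f (suc i)
  0≢suc i eq with () ← f-inj eq
  f′ : Fin k → Fin (k + m)
  f′ i = punchOut (0≢suc i)
  f′-inj : Injective _≡_ _≡_ f′
  f′-inj eq = Fin.suc-injective (f-inj (punchOut-injective (0≢suc _) (0≢suc _) eq))
  π′ = proj₁ (extend k f′ f′-inj)
  later : ∀ i → insert (f zero) zero π′ ⟨$⟩ʳ f (suc i) ≡ suc (i ↑ˡ m)
  later i = begin
    insert (f zero) zero π′ ⟨$⟩ʳ f (suc i)                    ≡⟨ cong (insert (f zero) zero π′ ⟨$⟩ʳ_)
                                                                      (punchIn-punchOut (0≢suc i)) ⟨
    insert (f zero) zero π′ ⟨$⟩ʳ punchIn (f zero) (f′ i)      ≡⟨ insert-punchIn (f zero) zero π′ (f′ i) ⟩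
    suc (π′ ⟨$⟩ʳ f′ i)                                        ≡⟨ cong suc (proj₂ (extend k f′ f′-inj) i) ⟩
    suc (i ↑ˡ m)                                              ∎
    where open ≡-Reasoning

clique-injective : {G : Graph (Fin n)} {k : ℕ} {f : Fin k → Fin n} →
                   (∀ {i j} → i ≢ j → G [ f i ~ f j ]) → Injective _≡_ _≡_ f
clique-injective {G = G} clique {i} {j} eq =
  decidable-stable (i ≟ j) λ i≢j → adjacent⇒≢ G (clique i≢j) eq

labelled⇒≅ : {G : Graph (Fin (4 + t))} (K : K4Plus G) (φ : Fin (4 + t) ↔ (Fin 4 ⊎ Fin t)) →
             (∀ i → Inverse.to φ (K4Plus.corner K i) ≡ inj₁ i) → G ≅ K⁺ 4 t
labelled⇒≅ {t} {G} K φ to-corner =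
  φ , λ u v → mk⇔
    (λ u~v → to-K⁺ (to u) (to v) (subst₂ (λ x y → G [ x ~ y ]) (sym (from-to u)) (sym (from-to v)) u~v))
    (λ e → subst₂ (λ x y → G [ x ~ y ]) (from-to u) (from-to v) (from-K⁺ (to u) (to v) e))
  where
  open K4Plus K
  open Inverse φ using (to; from)
  from-to : ∀ u → from (to u) ≡ u
  from-to u = Inverse.strictlyInverseʳ φ u
  to-from : ∀ x → to (from x) ≡ x
  to-from x = Inverse.strictlyInverseˡ φ x
  from-corner : ∀ i → from (inj₁ i) ≡ corner i
  from-corner i = trans (cong from (sym (to-corner i))) (from-to (corner i))
  leaf≢corner : ∀ l i → from (inj₂ l) ≢ corner i
  leaf≢corner l i eq = contradiction (trans (sym (to-from (inj₂ l))) (trans (cong to eq) (to-corner i))) λ ()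
  -- By `confined`, an edge avoiding `corner zero` starts at a corner, and a vertex labelled as a
  -- leaf is not a corner.
  leaf-edge : ∀ {u l} → u ≢ corner zero → ¬ G [ from (inj₂ l) ~ u ]
  leaf-edge {l = l} u≢ e with confined e (leaf≢corner l zero) u≢
  ... | i , eq = leaf≢corner l i eq
  corner-leaf : ∀ {i l} → G [ from (inj₂ l) ~ from (inj₁ i) ] → i ≡ zero
  corner-leaf {i} e = decidable-stable (i ≟ zero) λ i≢0 →
    leaf-edge (λ eq → i≢0 (clique-injective {G = G} clique (trans (sym (from-corner i)) eq))) e
  to-K⁺ : ∀ x y → G [ from x ~ from y ] → K⁺ 4 t [ x ~ y ]
  to-K⁺ (inj₁ i) (inj₁ j) e = λ { refl → Graph.irrefl G refl e }
  to-K⁺ (inj₁ i) (inj₂ l) e = corner-leaf (Graph.symm G e)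
  to-K⁺ (inj₂ l) (inj₁ i) e = corner-leaf e
  to-K⁺ (inj₂ l) (inj₂ _) e = leaf-edge (leaf≢corner _ zero) e
  spoke : ∀ l → G [ from (inj₁ zero) ~ from (inj₂ l) ]
  spoke l = subst (λ x → G [ x ~ from (inj₂ l) ]) (sym (from-corner zero)) (dominating (leaf≢corner l zero))
  from-K⁺ : ∀ x y → K⁺ 4 t [ x ~ y ] → G [ from x ~ from y ]
  from-K⁺ (inj₁ i) (inj₁ j) i≢j =
    subst₂ (λ x y → G [ x ~ y ]) (sym (from-corner i)) (sym (from-corner j)) (clique i≢j)
  from-K⁺ (inj₁ _) (inj₂ l) refl = spoke l
  from-K⁺ (inj₂ l) (inj₁ _) refl = Graph.symm G (spoke l)

K4Plus⇒≅ : {G : Graph (Fin (4 + t))} → K4Plus G → G ≅ K⁺ 4 t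
K4Plus⇒≅ {t} {G} K = labelled⇒≅ K (↔-trans (proj₁ extended) +↔⊎)
  (λ i → trans (cong (splitAt 4) (proj₂ extended i)) (splitAt-↑ˡ 4 i t))
  where extended = extend 4 (K4Plus.corner K) (clique-injective {G = G} (K4Plus.clique K))

-- The size of the extremal graph.

-- `size` and `Saturated` need the vertex type `Fin n`, so `K⁺ 4 t` is transported along `splitAt`.
model : ∀ t → Graph (Fin (4 + t))
model t = record
  { _~_    = λ u v → K⁺ 4 t [ splitAt 4 u ~ splitAt 4 v ]
  ; symm   = λ {u} {v} → Graph.symm (K⁺ 4 t) {splitAt 4 u} {splitAt 4 v}
  ; irrefl = λ { {u} refl → Graph.irrefl (K⁺ 4 t) {splitAt 4 u} refl }
  ; _~?_   = λ u v → K⁺ 4 t [ splitAt 4 u ~? splitAt 4 v ]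
  }

model≅K⁺ : ∀ t → model t ≅ K⁺ 4 t
model≅K⁺ t = +↔⊎ , λ _ _ → mk⇔ id id

-- The leaf-bearing vertex has degree `3 + t`, the other three corners 3 each, and the `t` leaves 1
-- each.
degree-sum-model : ∀ t → sum (deg (model t)) ≡ (4 + t + 2) + (4 + t + 2)
degree-sum-model t = trans
  (cong₂ _+_ (cong (3 +_) ones)
    (cong₂ _+_ corner-row (cong₂ _+_ corner-row (cong₂ _+_ corner-row leaf-rows))))
  (solve 1 (λ t → con 3 :+ t :+ (con 3 :+ (con 3 :+ (con 3 :+ t)))
              := (con 4 :+ t :+ con 2) :+ (con 4 :+ t :+ con 2)) refl t)
  where
  ones : sum {t} (λ _ → 1) ≡ t
  ones = trans (sum-const t 1) (*-identityʳ t)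
  corner-row : 3 + sum {t} (λ _ → 0) ≡ 3
  corner-row = cong (3 +_) (sum-replicate-zero t)
  leaf-rows : sum {t} (λ _ → 1 + sum {t} (λ _ → 0)) ≡ t
  leaf-rows = trans (sum-cong-≗ {t} (λ _ → cong suc (sum-replicate-zero t))) ones

halve : ∀ a b → a + a ≡ b + b → a ≡ b
halve a b eq = *-cancelˡ-≡ a b 2 (trans (cong (a +_) (+-identityʳ a)) (trans eq (cong (b +_) (sym (+-identityʳ b)))))

-- `size` depends on the order of the vertices, whereas the degree sum is visibly invariant under
-- relabelling; hence the detour through `handshake`.
≅⇒size≡ : ∀ {m n} {G : Graph (Fin m)} {H : Graph (Fin n)} → G ≅ H → size G ≡ size H
≅⇒size≡ {G = G} {H} (π , edges) = halve (size G) (size H) (begin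
  size G + size G                                    ≡⟨ handshake G ⟨
  sum (deg G)                                        ≡⟨ sum-cong-≗ (λ u → sum-cong-≗ (λ v → entry u v)) ⟩
  sum (λ u → sum (λ v → E (π ⟨$⟩ʳ u) (π ⟨$⟩ʳ v)))    ≡⟨ sum-cong-≗ (λ u → sum-permute (E (π ⟨$⟩ʳ u)) π) ⟨
  sum (λ u → sum (E (π ⟨$⟩ʳ u)))                     ≡⟨ sum-permute (λ i → sum (E i)) π ⟨
  sum (deg H)                                        ≡⟨ handshake H ⟩
  size H + size H                                    ∎)
  where
  open ≡-Reasoning
  E : _ → _ → ℕ
  E i j = χ (H [ i ~? j ])
  entry : ∀ u v → χ (G [ u ~? v ]) ≡ E (π ⟨$⟩ʳ u) (π ⟨$⟩ʳ v)
  entry u v = χ-cong (G [ u ~? v ]) (H [ π ⟨$⟩ʳ u ~? π ⟨$⟩ʳ v ])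
                (Equivalence.to (edges u v)) (Equivalence.from (edges u v))

≅K⁺⇒≅model : {G : Graph (Fin (4 + t))} → G ≅ K⁺ 4 t → G ≅ model t
≅K⁺⇒≅model {t} {G} (φ , edges) = ↔-trans φ (↔-sym +↔⊎) , λ u v →
  subst₂ (λ x y → G [ u ~ v ] ⇔ K⁺ 4 t [ x ~ y ])
    (sym (splitAt-join 4 t (Inverse.to φ u))) (sym (splitAt-join 4 t (Inverse.to φ v))) (edges u v)

≅⇒size : {G : Graph (Fin (4 + t))} → G ≅ K⁺ 4 t → size G ≡ 4 + t + 2
≅⇒size {t} {G} iso = trans (≅⇒size≡ {G = G} {H = model t} (≅K⁺⇒≅model {G = G} iso))
  (halve (size (model t)) (4 + t + 2) (trans (sym (handshake (model t))) (degree-sum-model t)))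

-- Saturation of the extremal graph.

length≤labels : ∀ {A B : Set} {k} (f : A → Fin k ⊎ B) → (∀ {x y} → f x ≡ f y → x ≡ y) →
                {ys : List A} → Unique ys → All (λ x → ∃ λ i → f x ≡ inj₁ i) ys → length ys ≤ k
length≤labels f f-inj {ys} ys! labelled = injective⇒≤ {f = λ i → proj₁ (label i)} λ {i} {j} eq →
  lookup-injective ys! (f-inj (trans (proj₂ (label i)) (trans (cong inj₁ eq) (sym (proj₂ (label j))))))
  where
  label : ∀ i → ∃ λ k → f (lookup ys i) ≡ inj₁ k
  label i = All.lookup labelled (∈-lookup {xs = ys} i)

-- A leaf has a single neighbour, so it lies in no triangle.
triangle⇒clique-vertex : ∀ (x y z : Fin 4 ⊎ Fin t) → K⁺ 4 t [ x ~ y ] → K⁺ 4 t [ x ~ z ] → K⁺ 4 t [ y ~ z ] →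
                         ∃ λ i → x ≡ inj₁ i
triangle⇒clique-vertex (inj₁ i) _ _ _ _ _ = i , refl
triangle⇒clique-vertex (inj₂ _) (inj₁ _) (inj₁ _) refl refl 0≢0 = contradiction refl 0≢0

K⁺-dominating : ∀ (x : Fin 4 ⊎ Fin t) → x ≢ inj₁ zero → K⁺ 4 t [ inj₁ zero ~ x ]
K⁺-dominating (inj₁ i) x≢ = λ { refl → x≢ refl }
K⁺-dominating (inj₂ _) _  = refl

two-others : ∀ (k : Fin 4) → Σ[ i ∈ Fin 4 ] Σ[ j ∈ Fin 4 ] (i ≢ j × (i ≢ k × i ≢ zero) × (j ≢ k × j ≢ zero))
two-others zero                   = suc zero , suc (suc zero) , (λ ()) , ((λ ()) , λ ()) , ((λ ()) , λ ())
two-others (suc zero)             = suc (suc zero) , suc (suc (suc zero)) , (λ ()) , ((λ ()) , λ ()) , ((λ ()) , λ ())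
two-others (suc (suc zero))       = suc zero , suc (suc (suc zero)) , (λ ()) , ((λ ()) , λ ()) , ((λ ()) , λ ())
two-others (suc (suc (suc zero))) = suc zero , suc (suc zero) , (λ ()) , ((λ ()) , λ ()) , ((λ ()) , λ ())

Spare : (x y : Fin 4 ⊎ Fin t) → Fin 4 → Set
Spare x y i = inj₁ i ≢ x × inj₁ i ≢ y × i ≢ zero

-- At most one of two non-adjacent vertices belongs to the clique, so two of the three clique
-- vertices other than `zero` are free.
spare-edge : ∀ (x y : Fin 4 ⊎ Fin t) → x ≢ y → ¬ K⁺ 4 t [ x ~ y ] →
             Σ[ i ∈ Fin 4 ] Σ[ j ∈ Fin 4 ] (i ≢ j × Spare x y i × Spare x y j)
spare-edge (inj₁ i) (inj₁ j) x≢y x≁y = contradiction (λ { refl → x≢y refl }) x≁y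
spare-edge (inj₁ k) (inj₂ _) _ _ with two-others k
... | i , j , i≢j , (i≢k , i≢0) , (j≢k , j≢0) =
  i , j , i≢j , (i≢k ∘ inj₁-injective , (λ ()) , i≢0) , (j≢k ∘ inj₁-injective , (λ ()) , j≢0)
spare-edge (inj₂ _) (inj₁ k) _ _ with two-others k
... | i , j , i≢j , (i≢k , i≢0) , (j≢k , j≢0) =
  i , j , i≢j , ((λ ()) , i≢k ∘ inj₁-injective , i≢0) , ((λ ()) , j≢k ∘ inj₁-injective , j≢0)
spare-edge (inj₂ _) (inj₂ _) _ _ with two-others zero
... | i , j , i≢j , (_ , i≢0) , (_ , j≢0) = i , j , i≢j , ((λ ()) , (λ ()) , i≢0) , ((λ ()) , (λ ()) , j≢0)

module _ {G : Graph (Fin n)} (iso : G ≅ K⁺ 4 t) where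
  private
    open Inverse (proj₁ iso) using (to; from)

    from-to : ∀ u → from (to u) ≡ u
    from-to u = Inverse.strictlyInverseʳ (proj₁ iso) u

    to-from : ∀ x → to (from x) ≡ x
    to-from x = Inverse.strictlyInverseˡ (proj₁ iso) x

    to-injective : ∀ {u v} → to u ≡ to v → u ≡ v
    to-injective {u} {v} eq = trans (sym (from-to u)) (trans (cong from eq) (from-to v))

    to-edge : ∀ {u v} → G [ u ~ v ] → K⁺ 4 t [ to u ~ to v ]
    to-edge = Equivalence.to (proj₂ iso _ _)

    from-edge : ∀ {u v} → K⁺ 4 t [ to u ~ to v ] → G [ u ~ v ]
    from-edge = Equivalence.from (proj₂ iso _ _)

  -- A centre and its four ends would be five distinct vertices, each in a triangle, hence five
  -- vertices of a clique on four.
  ≅⇒free : ¬ (Fan q ⊑ G)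
  ≅⇒free F⊑G with ⊑⇒centre {G = G} F⊑G
  ... | c , _ , twoEdges {p} {p′} {r} {r′} p~p′ r~r′ distinct spokes@(c~p ∷ c~p′ ∷ c~r ∷ c~r′ ∷ []) =
    1+n≰n (length≤labels to to-injective vertices! all-indexed)
    where
    vertices = c ∷ p ∷ p′ ∷ r ∷ r′ ∷ []
    vertices! : Unique vertices
    vertices! = All.map (adjacent⇒≢ G) spokes ∷ distinct
    Indexed : Fin n → Set
    Indexed x = ∃ λ i → to x ≡ inj₁ i
    indexed : ∀ {x y z} → G [ x ~ y ] → G [ x ~ z ] → G [ y ~ z ] → Indexed x
    indexed xy xz yz = triangle⇒clique-vertex _ _ _ (to-edge xy) (to-edge xz) (to-edge yz)
    ~-sym = Graph.symm G
    all-indexed : All Indexed vertices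
    all-indexed = indexed c~p c~p′ p~p′ ∷ indexed (~-sym c~p) p~p′ c~p′ ∷ indexed (~-sym c~p′) (~-sym p~p′) c~p ∷
      indexed (~-sym c~r) r~r′ c~r′ ∷ indexed (~-sym c~r′) (~-sym r~r′) c~r ∷ []

  -- Adding `uv` makes the dominating vertex `w` a centre: `uv` is one edge, and the other joins two
  -- clique vertices different from `u`, `v` and `w`.
  ≅⇒saturated : q + 5 ≤ n → Saturated (Fan q) G
  ≅⇒saturated {q} q+5≤n = ≅⇒free , completes
    where
    w = from (inj₁ zero)
    ≢w : ∀ {x} → to x ≢ inj₁ zero → x ≢ w
    ≢w ne refl = ne (to-from (inj₁ zero))
    dominating : ∀ {x} → x ≢ w → G [ w ~ x ]
    dominating {x} x≢w = from-edge (subst (λ z → K⁺ 4 t [ z ~ to x ]) (sym (to-from (inj₁ zero)))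
      (K⁺-dominating (to x) (λ eq → x≢w (trans (sym (from-to x)) (cong from eq)))))
    completes : ∀ u v (e : complement G [ u ~ v ]) → Fan q ⊑ addEdge G (proj₁ e)
    completes u v (u≢v , u≁v) with spare-edge (to u) (to v) (u≢v ∘ to-injective) (u≁v ∘ from-edge)
    ... | i , j , i≢j , (i≢u , i≢v , i≢0) , (j≢u , j≢v , j≢0) =
      centre⇒⊑ {G = addEdge G u≢v} {c = w} (q+4≤deg , twoEdges (inj₂ (inj₁ (refl , refl))) (inj₁ y~z)
        ((u≢v ∷ ≢-sym (corner≢ i≢u) ∷ ≢-sym (corner≢ j≢u) ∷ []) ∷
         (≢-sym (corner≢ i≢v) ∷ ≢-sym (corner≢ j≢v) ∷ []) ∷ (adjacent⇒≢ G y~z ∷ []) ∷ [] ∷ [])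
        (spoke u≢w ∷ spoke v≢w ∷ spoke (corner≢w i≢0) ∷ spoke (corner≢w j≢0) ∷ []))
      where
      corner≢ : ∀ {k x} → inj₁ k ≢ to x → from (inj₁ k) ≢ x
      corner≢ {k} ne refl = ne (sym (to-from (inj₁ k)))
      corner≢w : ∀ {k} → k ≢ zero → from (inj₁ k) ≢ w
      corner≢w {k} k≢0 = ≢w (λ eq → k≢0 (inj₁-injective (trans (sym (to-from (inj₁ k))) eq)))
      y~z : G [ from (inj₁ i) ~ from (inj₁ j) ]
      y~z = from-edge (subst₂ (λ x y → K⁺ 4 t [ x ~ y ]) (sym (to-from (inj₁ i))) (sym (to-from (inj₁ j))) i≢j)
      u≢w : u ≢ w
      u≢w refl = u≁v (dominating (≢-sym u≢v))
      v≢w : v ≢ w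
      v≢w refl = u≁v (Graph.symm G (dominating u≢v))
      spoke : ∀ {x} → x ≢ w → addEdge G u≢v [ w ~ x ]
      spoke x≢w = inj₁ (dominating x≢w)
      q+4≤deg : q + 4 ≤ deg (addEdge G u≢v) w
      q+4≤deg = +-cancelʳ-≤ 1 (q + 4) (deg (addEdge G u≢v) w) (≤-trans (≤-reflexive (+-assoc q 4 1)) (≤-trans q+5≤n
        (count-cofinite (addEdge G u≢v [ w ~?_]) {w ∷ []} ([] ∷ []) (λ x x∉ → spoke (x∉ ∘ here)))))

-- The saturation number and uniqueness.

-- The degree sum is twice the size, so by parity `2 * n + 5` already forces size at least `n + 3`.
saturated⇒K4Plus⊎large : (G : Graph (Fin n)) → Saturated (Fan q) G → 1 ≤ q → q + 5 ≤ n →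
                         K4Plus G ⊎ n + 3 ≤ size G
saturated⇒K4Plus⊎large {n} G sat 1≤q q+5≤n with SaturatedGraph.K4Plus⊎large G sat 1≤q q+5≤n
... | inj₁ k4   = inj₁ k4
... | inj₂ 2n+5≤ = inj₂ (≮⇒≥ λ size<n+3 → <-irrefl refl (begin-strict
  2 * n + 4                <⟨ ≤-reflexive (sym (+-suc (2 * n) 4)) ⟩
  2 * n + 5                ≤⟨ 2n+5≤ ⟩
  sum (deg G)              ≡⟨ handshake G ⟩
  size G + size G          ≤⟨ +-mono-≤ (m<n+3⇒m≤n+2 size<n+3) (m<n+3⇒m≤n+2 size<n+3) ⟩
  (n + 2) + (n + 2)        ≡⟨ solve 1 (λ n → (n :+ con 2) :+ (n :+ con 2) := con 2 :* n :+ con 4) refl n ⟩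
  2 * n + 4                ∎))
  where
  open ≤-Reasoning
  m<n+3⇒m≤n+2 : ∀ {m} → suc m ≤ n + 3 → m ≤ n + 2
  m<n+3⇒m≤n+2 le = ≤-pred (≤-trans le (≤-reflexive (+-suc n 2)))

-- Writing `n` as `4 + t` makes `n ∸ 4` compute to `t`.
theorem-for-4+t : (q t : ℕ) → 1 ≤ q → q + 5 ≤ 4 + t →
  IsSat (4 + t) (Fan q) (4 + t + 2) ×
  ((G : Graph (Fin (4 + t))) → InSAT (4 + t) (Fan q) G ⇔ (G ≅ K⁺ 4 t))
theorem-for-4+t q t 1≤q q+5≤n = isSat , λ G → mk⇔ (inSAT⇒≅ G) (≅⇒inSAT G)
  where
  model-saturated : Saturated (Fan q) (model t)
  model-saturated = ≅⇒saturated {G = model t} (model≅K⁺ t) q+5≤n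
  model-size : size (model t) ≡ 4 + t + 2
  model-size = ≅⇒size {G = model t} (model≅K⁺ t)
  minimum : (G : Graph (Fin (4 + t))) → Saturated (Fan q) G → 4 + t + 2 ≤ size G
  minimum G sat with saturated⇒K4Plus⊎large G sat 1≤q q+5≤n
  ... | inj₁ k4    = ≤-reflexive (sym (≅⇒size {G = G} (K4Plus⇒≅ {G = G} k4)))
  ... | inj₂ large = ≤-trans (+-monoʳ-≤ (4 + t) (n≤1+n 2)) large
  isSat : IsSat (4 + t) (Fan q) (4 + t + 2)
  isSat = (model t , model-saturated , model-size) , minimum
  inSAT⇒≅ : ∀ G → InSAT (4 + t) (Fan q) G → G ≅ K⁺ 4 t
  -- In the large case `G` would have at least `n + 3` edges, against the `n + 2` of the saturated
  -- `model t`.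
  inSAT⇒≅ G (sat , _ , least) with saturated⇒K4Plus⊎large G sat 1≤q q+5≤n
  ... | inj₁ k4    = K4Plus⇒≅ {G = G} k4
  ... | inj₂ large = contradiction
    (≤-trans large (≤-trans (least (model t) model-saturated) (≤-reflexive model-size)))
    (<⇒≱ (+-monoʳ-< (4 + t) (n<1+n 2)))
  ≅⇒inSAT : ∀ G → G ≅ K⁺ 4 t → InSAT (4 + t) (Fan q) G
  ≅⇒inSAT G iso =
    ≅⇒saturated {G = G} iso q+5≤n , subst (IsSat (4 + t) (Fan q)) (sym (≅⇒size {G = G} iso)) isSat

theorem1p4 : (q n : ℕ) → q ≥ 1 → n ≥ q + 5 →
    IsSat n (K 1 ∨ (2 · K 2 ∪ q · K 1)) (n + 2) ×
    ((G : Graph (Fin n)) →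
    InSAT n (K 1 ∨ (2 · K 2 ∪ q · K 1)) G ⇔ (G ≅ K⁺ 4 (n ∸ 4)))
theorem1p4 q n q≥1 n≥q+5 with m≤n⇒∃[o]m+o≡n (≤-trans (≤-trans (n≤1+n 4) (m≤n+m 5 q)) n≥q+5)
... | t , refl = theorem-for-4+t q t q≥1 n≥q+5
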